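{- Let $\mathcal{A},\mathcal{B}$ be finite alphabets. Let $\varphi\colon \mathcal{A}\to\mathcal{A}^*$ be a primitive, left-proper substitution, let $M_{\varphi}$ denote the incidence matrix of $\varphi$, and let $s$ denote the size of the largest Jordan block of $M_{\varphi}$ corresponding to the eigenvalue $0$ (with $s=0$ if $0$ is not an eigenvalue of $M_\varphi$). Let $\tau\colon \mathcal{A}\to\mathcal{B}$ be a coding, let $x$ be a one-sided or an admissible two-sided fixed point of $\varphi$, let $y=\tau(x)$ and assume that $y$ is not periodic. The following conditions are equivalent: (i) $y$ is automatic; (ii) the row vector $(|\varphi^s(a)|)_{a\in\mathcal{A}}$ is a left eigenvector of $M_{\varphi}$.
   Context: For a finite alphabet $\mathcal{A}$, $\mathcal{A}^*$ is the set of finite words over $\mathcal{A}$ and $|u|$ is the length of a word $u$. One-sided sequences are elements of $\mathcal{A}^{\mathbf{N}}$, $\mathbf{N}=\{0,1,2,\dots\}$; two-sided sequences are elements of $\mathcal{A}^{\mathbf{Z}}$. A substitution is a map $\varphi\colon\mathcal{A}\to\mathcal{A}^*$, extended to words by concatenation and to sequences; on two-sided sequences $\varphi(\ldots x_{ -1}.x_0\ldots)=\ldots\varphi(x_{ -1}).\varphi(x_0)\ldots$, where the dot marks the position $0$. It has constant length $k$ if $|\varphi(b)|=k$ for all $b\in\mathcal{A}$. It is left-proper if all words $\varphi(b)$, $b\in\mathcal{A}$, share the same initial letter. A coding is a map $\mathcal{A}\to\mathcal{B}$, applied letterwise. A fixed point of $\varphi$ is a sequence $x$ with $\varphi(x)=x$;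 a two-sided fixed point $x$ is admissible if the word $x_{ -1}x_0$ appears in $\varphi^n(b)$ for some $b\in\mathcal{A}$, $n\geq1$. The incidence matrix is $M_\varphi=(|\varphi(b)|_c)_{c,b\in\mathcal{A}}$ (row index $c$, column index $b$), where $|\varphi(b)|_c$ is the number of occurrences of $c$ in $\varphi(b)$. $\varphi$ is primitive if some power $M_\varphi^n$, $n\geq1$, has all entries strictly positive. For $k\geq2$, a (one-sided or two-sided) sequence is $k$-automatic if it is the image under a coding of a (one-sided, resp. two-sided) fixed point of a substitution of constant length $k$; it is automatic if it is $k$-automatic for some $k\geq2$. -}

module Defs where

open import Level using (Level; _⊔_) renaming (suc to lsuc)
open import Algebra.Apartness.Bundles using (HeytingField; HeytingCommutativeRing)
open import Algebra.Bundles using (CommutativeRing; Semiring)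
import Algebra.Definitions.RawMonoid as RawMonoidOps
import Algebra.Properties.Semiring.Sum as SemiringSum
open import Data.Fin using (Fin; toℕ; splitAt)
import Data.Fin.Properties as Fin
open import Data.Integer as ℤ using (ℤ; +_; -_; -[1+_])
open import Data.List using (List; []; _∷_; [_]; length; map; filter; concatMap; applyUpTo)
open import Data.List.Extrema.Nat using (max)
open import Data.List.Relation.Binary.Infix.Heterogeneous using (Infix)
open import Data.Nat as ℕ using (ℕ; zero; suc; NonZero; _≤_; _<_)
open import Data.Nat.GeneralisedArithmetic using (fold)
open import Data.Nat.Properties using (+-*-semiring)
open import Data.Product using (Σ-syntax; ∃-syntax; _×_; proj₁; proj₂)
open import Data.Sum using (inj₁; inj₂)
open import Relation.Binary.Definitions using (Decidable)
open import Relation.Binary.PropositionalEquality using (_≡_)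
open import Relation.Nullary using (¬_; Dec; yes; no)
open import Relation.Nullary.Decidable using (⌊_⌋)
open import Data.Bool using (if_then_else_)

------------------------------------------------------------------------
-- Matrices

module Matrices {c ℓ} (R : Semiring c ℓ) where
  open Semiring R
  open SemiringSum R using (sum)

  Matrix : ℕ → ℕ → Set c
  Matrix m n = Fin m → Fin n → Carrier

  infix 4 _≈ᴹ_
  _≈ᴹ_ : ∀ {m n} → Matrix m n → Matrix m n → Set ℓ
  A ≈ᴹ B = ∀ i j → A i j ≈ B i j

  1ᴹ : ∀ {n} → Matrix n n
  1ᴹ i j = if ⌊ i Fin.≟ j ⌋ then 1# else 0#

  infixl 7 _*ᴹ_
  _*ᴹ_ : ∀ {l m n} → Matrix l m → Matrix m n → Matrix l n
  (A *ᴹ B) i k = sum (λ j → A i j * B j k)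

  infixr 8 _^ᴹ_
  _^ᴹ_ : ∀ {n} → Matrix n n → ℕ → Matrix n n
  A ^ᴹ zero  = 1ᴹ
  A ^ᴹ suc n = A *ᴹ (A ^ᴹ n)

  -- The product of a row vector and a matrix.
  infixl 7 _ᵛ*ᴹ_
  _ᵛ*ᴹ_ : ∀ {m n} → (Fin m → Carrier) → Matrix m n → (Fin n → Carrier)
  (v ᵛ*ᴹ A) j = sum (λ i → v i * A i j)

------------------------------------------------------------------------
-- Fields of characteristic zero

-- A field for the eigenvalues. The intended instances are ℂ and the algebraic
-- numbers, over which every integer matrix has a Jordan normal form; the sizes
-- of the Jordan blocks for the eigenvalue 0 are the same over any field of
-- characteristic zero over which a Jordan normal form exists.
-- The decidability of _#_ makes apartness the negation of equality.

record CharZeroField (c ℓ₁ ℓ₂ : Level) : Set (lsuc (c ⊔ ℓ₁ ⊔ ℓ₂)) where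
  field
    heytingField : HeytingField c ℓ₁ ℓ₂

  open HeytingField heytingField public

  semiring : Semiring c ℓ₁
  semiring = CommutativeRing.semiring
    (HeytingCommutativeRing.commutativeRing heytingCommutativeRing)

  open RawMonoidOps (Semiring.+-rawMonoid semiring) using () renaming (_×_ to _·_)

  fromℕ : ℕ → Carrier
  fromℕ n = n · 1#

  field
    _#?_     : Decidable _#_
    charZero : ∀ n → fromℕ (suc n) # 0#

  _≈?_ : Decidable _≈_
  x ≈? y with x #? y
  ... | yes x#y = no (λ x≈y → proj₂ (tight x y) x≈y x#y)
  ... | no ¬x#y = yes (proj₁ (tight x y) ¬x#y)

------------------------------------------------------------------------
-- Eigenvectors and Jordan normal form

module Spectral {c ℓ₁ ℓ₂} (K : CharZeroField c ℓ₁ ℓ₂) where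
  open CharZeroField K
  open Matrices semiring

  fromℕᴹ : ∀ {m n} → (Fin m → Fin n → ℕ) → Matrix m n
  fromℕᴹ A i j = fromℕ (A i j)

  IsLeftEigenvector : ∀ {n} → (Fin n → Carrier) → Matrix n n → Set _
  IsLeftEigenvector v A =
    ¬ (∀ i → v i ≈ 0#) × (∃[ μ ] ∀ j → (v ᵛ*ᴹ A) j ≈ μ * v j)

  record JordanBlock : Set c where
    field
      size        : ℕ
      eigenvalue  : Carrier
      .{{size≢0}} : NonZero size

  open JordanBlock public

  blockMatrix : (b : JordanBlock) → Matrix (size b) (size b)
  blockMatrix b i j =
    if ⌊ i Fin.≟ j ⌋ then eigenvalue b else
    if ⌊ suc (toℕ i) ℕ.≟ toℕ j ⌋ then 1# else 0#

  totalSize : List JordanBlock → ℕ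
  totalSize []       = 0
  totalSize (b ∷ bs) = size b ℕ.+ totalSize bs

  blockDiagonal : (bs : List JordanBlock) → Matrix (totalSize bs) (totalSize bs)
  blockDiagonal (b ∷ bs) i j with splitAt (size b) i | splitAt (size b) j
  ... | inj₁ i′ | inj₁ j′ = blockMatrix b i′ j′
  ... | inj₂ i′ | inj₂ j′ = blockDiagonal bs i′ j′
  ... | inj₁ _  | inj₂ _  = 0#
  ... | inj₂ _  | inj₁ _  = 0#

  -- A = P J P⁻¹ with J block diagonal. The sizes n and totalSize blocks are
  -- equal only propositionally, so P is typed as a rectangular matrix.
  record JordanForm {n : ℕ} (A : Matrix n n) : Set (c ⊔ ℓ₁) where
    field
      blocks      : List JordanBlock
      totalSize≡n : totalSize blocks ≡ n
      P           : Matrix n (totalSize blocks)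
      P⁻¹         : Matrix (totalSize blocks) n
      P*P⁻¹       : P *ᴹ P⁻¹ ≈ᴹ 1ᴹ
      P⁻¹*P       : P⁻¹ *ᴹ P ≈ᴹ 1ᴹ
      similar     : A ≈ᴹ P *ᴹ blockDiagonal blocks *ᴹ P⁻¹

  -- The value is 0 when no block has eigenvalue μ, i.e. when μ is not an
  -- eigenvalue of A.
  largestBlockSize : ∀ {n} {A : Matrix n n} → JordanForm A → Carrier → ℕ
  largestBlockSize J μ =
    max 0 (map size (filter (λ b → eigenvalue b ≈? μ) (JordanForm.blocks J)))

------------------------------------------------------------------------
-- Substitutions; the finite alphabet with m letters is Fin m

Word : ℕ → Set
Word m = List (Fin m)

Substitution : ℕ → Set
Substitution m = Fin m → Word m

iterateSubst : ∀ {m} → Substitution m → ℕ → Word m → Word m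
iterateSubst φ n w = fold w (concatMap φ) n

HasConstantLength : ∀ {m} → ℕ → Substitution m → Set
HasConstantLength k φ = ∀ b → length (φ b) ≡ k

LeftProper : ∀ {m} → Substitution m → Set
LeftProper φ = ∃[ a ] ∀ b → ∃[ w ] φ b ≡ a ∷ w

occurrences : ∀ {m} → Fin m → Word m → ℕ
occurrences c w = length (filter (c Fin.≟_) w)

incidenceMatrix : ∀ {m} → Substitution m → Fin m → Fin m → ℕ
incidenceMatrix φ c b = occurrences c (φ b)

Primitive : ∀ {m} → Substitution m → Set
Primitive φ = ∃[ n ] 1 ≤ n × (∀ c b → 0 < (incidenceMatrix φ ^ᴹ n) c b)
  where open Matrices +-*-semiring

------------------------------------------------------------------------
-- One-sided sequences

module OneSided where

  Seq : Set → Set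
  Seq A = ℕ → A

  prefix : ∀ {A} → Seq A → ℕ → List A
  prefix x n = applyUpTo x n

  -- y = φ(x). The second component only matters for erasing φ, where φ(x)
  -- could be a finite word and hence not a sequence.
  IsImage : ∀ {m} → Substitution m → Seq (Fin m) → Seq (Fin m) → Set
  IsImage φ x y =
      (∀ n → let w = concatMap φ (prefix x n) in prefix y (length w) ≡ w)
    × (∀ N → ∃[ n ] N ≤ length (concatMap φ (prefix x n)))

  IsFixedPoint : ∀ {m} → Substitution m → Seq (Fin m) → Set
  IsFixedPoint φ x = IsImage φ x x

  Periodic : ∀ {A} → Seq A → Set
  Periodic y = ∃[ p ] 1 ≤ p × (∀ i → y (i ℕ.+ p) ≡ y i)

  IsKAutomatic : ∀ {n} → ℕ → Seq (Fin n) → Set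
  IsKAutomatic {n} k y =
    ∃[ m ] Σ[ ψ ∈ Substitution m ] Σ[ π ∈ (Fin m → Fin n) ] Σ[ z ∈ Seq (Fin m) ]
      HasConstantLength k ψ × IsFixedPoint ψ z × (∀ i → y i ≡ π (z i))

  Automatic : ∀ {n} → Seq (Fin n) → Set
  Automatic y = ∃[ k ] 2 ≤ k × IsKAutomatic k y

------------------------------------------------------------------------
-- Two-sided sequences

module TwoSided where

  Seq : Set → Set
  Seq A = ℤ → A

  -- factor x i l = x_i x_{i+1} … x_{i+l-1}
  factor : ∀ {A} → Seq A → ℤ → ℕ → List A
  factor x i l = applyUpTo (λ j → x (i ℤ.+ + j)) l

  -- right x n = x_0 … x_{n-1}  and  left x n = x_{-n} … x_{-1}
  right left : ∀ {A} → Seq A → ℕ → List A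
  right x n = factor x (+ 0) n
  left  x n = factor x (- (+ n)) n

  -- y = φ(x), with φ(x_0) starting at position 0; as in the one-sided case,
  -- the length conditions only matter for erasing φ.
  IsImage : ∀ {m} → Substitution m → Seq (Fin m) → Seq (Fin m) → Set
  IsImage φ x y =
      (∀ n → let w = concatMap φ (right x n) in right y (length w) ≡ w)
    × (∀ n → let w = concatMap φ (left x n) in left y (length w) ≡ w)
    × (∀ N → ∃[ n ] N ≤ length (concatMap φ (right x n)))
    × (∀ N → ∃[ n ] N ≤ length (concatMap φ (left x n)))

  IsFixedPoint : ∀ {m} → Substitution m → Seq (Fin m) → Set
  IsFixedPoint φ x = IsImage φ x x

  Admissible : ∀ {m} → Substitution m → Seq (Fin m) → Set
  Admissible φ x = ∃[ b ] ∃[ n ]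
    1 ≤ n × Infix _≡_ (x -[1+ 0 ] ∷ x (+ 0) ∷ []) (iterateSubst φ n [ b ])

  Periodic : ∀ {A} → Seq A → Set
  Periodic y = ∃[ p ] 1 ≤ p × (∀ i → y (i ℤ.+ + p) ≡ y i)

  IsKAutomatic : ∀ {n} → ℕ → Seq (Fin n) → Set
  IsKAutomatic {n} k y =
    ∃[ m ] Σ[ ψ ∈ Substitution m ] Σ[ π ∈ (Fin m → Fin n) ] Σ[ z ∈ Seq (Fin m) ]
      HasConstantLength k ψ × IsFixedPoint ψ z × (∀ i → y i ≡ π (z i))

  Automatic : ∀ {n} → Seq (Fin n) → Set
  Automatic y = ∃[ k ] 2 ≤ k × IsKAutomatic k y

{-# OPTIONS --safe #-}
-- Write ℓₙ(b) = |φⁿ(b)| and s for the nilpotency index of the eigenvalue 0, so that ℓₙ₊₁ = ℓₙ M.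
--
-- If ℓₛ M = k ℓₛ, then k is an integer by descent, and k ≥ 2 because the lengths grow. Replacing each
-- letter b of x by (b,0) … (b,ℓₛ(b)−1) gives a fixed point of a substitution of constant length k,
-- which is mapped onto x = φˢ(x) by a coding. The left half of a two-sided sequence is treated as
-- a one-sided fixed point of the mirrored substitution.
--
-- Conversely, let y be k-automatic. All blocks φⁿ⁺¹(b) in x begin with φⁿ(a), so a prefix w of y of
-- length k^j ≤ ℓₙ(a) occurs at the beginning of each of them. Two occurrences of w at close but distinct
-- positions mod k^j inside the same pair of k^j-blocks would give w a short period, which would
-- make y periodic by linear recurrence; hence these positions fall into boundedly many classes
-- mod k^j. Descending boundedly many levels finds an n for which k^j divides a bounded multiple of all
-- the ℓₙ(b). For j maximal the quotients are bounded, so the vectors ℓₙ and ℓₙ₊ᵈ are proportional for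
-- some n and some large d, and ℓₙ is an eigenvector of M by Perron–Frobenius. Finally ℓₙ M = μ ℓₙ descends
-- to ℓₛ, as the kernel of M ^ s is the generalised kernel of M.
module Submission where

open import Defs
open import Algebra.Apartness.Bundles using (HeytingCommutativeRing)
open import Algebra.Bundles using (CommutativeRing; Semiring)
import Algebra.Properties.CommutativeSemigroup as CommutativeSemigroupProperties
import Algebra.Properties.Ring as RingProperties
import Algebra.Properties.Semiring.Mult as SemiringMult
import Algebra.Properties.Semiring.Sum as SemiringSum
open import Data.Fin
  using (Fin; zero; suc; toℕ; fromℕ<; splitAt; join; _↑ˡ_; _↑ʳ_; combine; remQuot; inject≤; funToFin; finToFun)
import Data.Fin.Properties as Fin
open import Data.List
  using ( List; []; _∷_; [_]; _++_; length; map; foldr; concat; concatMap; applyDownFrom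
        ; reverse; tabulate; lookup; take; drop; replicate)
open import Data.List.Extrema.Nat using (xs≤max)
open import Data.List.Membership.Propositional using (_∈_)
open import Data.List.Membership.Propositional.Properties using (∈-filter⁺; ∈-map⁺; ∈-++⁺ˡ; ∈-++⁺ʳ)
open import Data.List.Properties
  using ( ∷-injectiveˡ; ∷-injectiveʳ; ++-cancelˡ; ++-identityʳ; length-++; length-map; map-++; concatMap-++; concatMap-cong
        ; length-replicate; length-take; length-drop; drop-drop; take++drop≡id; tabulate-cong; tabulate-lookup
        ; length-tabulate; map-tabulate; length-applyUpTo; applyUpTo-∷ʳ; reverse-++; unfold-reverse
        ; reverse-involutive; length-reverse; reverse-map; reverse-applyUpTo)
import Data.List.Relation.Unary.All as All
open import Data.List.Relation.Unary.Any using (here; there)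
open import Data.Nat as ℕ using (ℕ; zero; suc; _≤_; _<_; z≤n; s≤s)
import Data.Nat.ListAction as ℕ
import Data.Nat.Properties as ℕ
open import Data.Product as Product using (∃-syntax; Σ-syntax; _×_; _,_; proj₁; proj₂)
open import Data.Sum as Sum using (_⊎_; inj₁; inj₂; [_,_]′)
open import Function using (_∘_; _⇔_; id; mk⇔)
open import Relation.Binary.Definitions using (tri<; tri≈; tri>)
open import Relation.Binary.PropositionalEquality as ≡ using (_≡_; _≢_)
import Relation.Binary.Reasoning.Setoid as SetoidReasoning
open import Relation.Nullary using (¬_; Dec; yes; no; contradiction; ¬?)
open import Relation.Nullary.Decidable using (decidable-stable)

-- Vectors, matrices and Jordan forms

module VectorMatrix {c ℓ} (R : Semiring c ℓ) where
  open Semiring R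
  open Matrices R
  open SemiringSum R
  open SetoidReasoning setoid

  private variable
    l m n : ℕ

  sum-zero : (f : Fin n → Carrier) → (∀ i → f i ≈ 0#) → sum f ≈ 0#
  sum-zero {n} f f≈0 = trans (sum-cong-≋ f≈0) (sum-replicate-zero n)

  sum-single : (f : Fin n → Carrier) (j : Fin n) → (∀ i → i ≢ j → f i ≈ 0#) → sum f ≈ f j
  sum-single {suc n} f j f≈0 = trans (sum-remove {i = j} f)
    (trans (+-congˡ (sum-zero _ (λ i → f≈0 _ (Fin.punchInᵢ≢i j i)))) (+-identityʳ (f j)))

  sum-split : ∀ m (f : Fin (m ℕ.+ n) → Carrier) → sum f ≈ sum (λ i → f (i ↑ˡ n)) + sum (λ i → f (m ↑ʳ i))
  sum-split zero    f = sym (+-identityˡ _)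
  sum-split (suc m) f = trans (+-congˡ (sum-split m (f ∘ suc))) (sym (+-assoc _ _ _))

  infix 4 _≈ᵛ_
  _≈ᵛ_ : (v w : Fin n → Carrier) → Set ℓ
  v ≈ᵛ w = ∀ i → v i ≈ w i

  0ᵛ : Fin n → Carrier
  0ᵛ _ = 0#

  ᵛ*ᴹ-congʳ : {v w : Fin m → Carrier} (A : Matrix m n) → v ≈ᵛ w → v ᵛ*ᴹ A ≈ᵛ w ᵛ*ᴹ A
  ᵛ*ᴹ-congʳ A v≈w j = sum-cong-≋ (λ i → *-congʳ (v≈w i))

  ᵛ*ᴹ-congˡ : (v : Fin m → Carrier) {A B : Matrix m n} → A ≈ᴹ B → v ᵛ*ᴹ A ≈ᵛ v ᵛ*ᴹ B
  ᵛ*ᴹ-congˡ v A≈B j = sum-cong-≋ (λ i → *-congˡ (A≈B i j))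

  ᵛ*ᴹ-assoc : (v : Fin l → Carrier) (A : Matrix l m) (B : Matrix m n) →
              (v ᵛ*ᴹ A) ᵛ*ᴹ B ≈ᵛ v ᵛ*ᴹ (A *ᴹ B)
  ᵛ*ᴹ-assoc v A B j = begin
    sum (λ k → sum (λ i → v i * A i k) * B k j)     ≈⟨ sum-cong-≋ (λ k → *-distribʳ-sum (B k j) (λ i → v i * A i k)) ⟩
    sum (λ k → sum (λ i → v i * A i k * B k j))     ≈⟨ ∑-comm (λ k i → v i * A i k * B k j) ⟩
    sum (λ i → sum (λ k → v i * A i k * B k j))     ≈⟨ sum-cong-≋ (λ i → sum-cong-≋ {x = λ k → v i * A i k * B k j} (λ k → *-assoc (v i) (A i k) (B k j))) ⟩
    sum (λ i → sum (λ k → v i * (A i k * B k j)))   ≈⟨ sum-cong-≋ (λ i → sym (*-distribˡ-sum (v i) (λ k → A i k * B k j))) ⟩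
    sum (λ i → v i * sum (λ k → A i k * B k j))     ∎

  0ᵛ-ᵛ*ᴹ : (A : Matrix m n) → 0ᵛ ᵛ*ᴹ A ≈ᵛ 0ᵛ
  0ᵛ-ᵛ*ᴹ A j = sum-zero _ (λ i → zeroˡ (A i j))

  ᵛ*ᴹ-identity : (v : Fin n → Carrier) → v ᵛ*ᴹ 1ᴹ ≈ᵛ v
  ᵛ*ᴹ-identity v j = trans (sum-single _ j off) on
    where
    off : ∀ i → i ≢ j → v i * 1ᴹ i j ≈ 0#
    off i i≢j with i Fin.≟ j
    ... | yes i≡j = contradiction i≡j i≢j
    ... | no  _   = zeroʳ (v i)
    on : v j * 1ᴹ j j ≈ v j
    on with j Fin.≟ j
    ... | yes _   = *-identityʳ (v j)
    ... | no  j≢j = contradiction ≡.refl j≢j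

  ᵛ*ᴹ-linear : ∀ α β (v w : Fin m → Carrier) (A : Matrix m n) →
    (λ i → α * v i + β * w i) ᵛ*ᴹ A ≈ᵛ (λ j → α * (v ᵛ*ᴹ A) j + β * (w ᵛ*ᴹ A) j)
  ᵛ*ᴹ-linear α β v w A j = begin
    sum (λ i → (α * v i + β * w i) * A i j)                         ≈⟨ sum-cong-≋ (λ i → trans (distribʳ (A i j) _ _) (+-cong (*-assoc α _ _) (*-assoc β _ _))) ⟩
    sum (λ i → α * (v i * A i j) + β * (w i * A i j))               ≈⟨ ∑-distrib-+ (λ i → α * (v i * A i j)) (λ i → β * (w i * A i j)) ⟩
    sum (λ i → α * (v i * A i j)) + sum (λ i → β * (w i * A i j))   ≈⟨ +-cong (*-distribˡ-sum α (λ i → v i * A i j)) (*-distribˡ-sum β (λ i → w i * A i j)) ⟨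
    α * (v ᵛ*ᴹ A) j + β * (w ᵛ*ᴹ A) j                               ∎

  act : Matrix n n → ℕ → (Fin n → Carrier) → (Fin n → Carrier)
  act A zero    v = v
  act A (suc k) v = act A k v ᵛ*ᴹ A

  act-cong : ∀ (A : Matrix n n) k {v w} → v ≈ᵛ w → act A k v ≈ᵛ act A k w
  act-cong A zero    v≈w = v≈w
  act-cong A (suc k) v≈w = ᵛ*ᴹ-congʳ A (act-cong A k v≈w)

  act-0ᵛ : ∀ (A : Matrix n n) k → act A k 0ᵛ ≈ᵛ 0ᵛ
  act-0ᵛ A zero    i = refl
  act-0ᵛ A (suc k) i = trans (ᵛ*ᴹ-congʳ A (act-0ᵛ A k) i) (0ᵛ-ᵛ*ᴹ A i)

  -- The generalised kernel of A is the kernel of A ^ s.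
  KernelStableAt : ℕ → Matrix n n → Set _
  KernelStableAt s A = ∀ k v → act A k v ≈ᵛ 0ᵛ → act A s v ≈ᵛ 0ᵛ

  injective⇒stable : ∀ s (A : Matrix n n) → (∀ v → v ᵛ*ᴹ A ≈ᵛ 0ᵛ → v ≈ᵛ 0ᵛ) → KernelStableAt s A
  injective⇒stable s A injective k v Aᵏv≈0 i = trans (act-cong A s (v≈0 k v Aᵏv≈0) i) (act-0ᵛ A s i)
    where
    v≈0 : ∀ k v → act A k v ≈ᵛ 0ᵛ → v ≈ᵛ 0ᵛ
    v≈0 zero    v eq = eq
    v≈0 (suc k) v eq = v≈0 k v (injective (act A k v) eq)

  -- The map v ↦ v P intertwines the actions of `A` and `B`, so the kernel of a power of `A` is
  -- carried into that of the same power of `B`; multiplying by `Q` brings the conclusion back.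
  similar⇒stable : ∀ s {A : Matrix m m} {B : Matrix n n} {P : Matrix m n} {Q : Matrix n m} →
    P *ᴹ Q ≈ᴹ 1ᴹ → Q *ᴹ P ≈ᴹ 1ᴹ → A ≈ᴹ P *ᴹ B *ᴹ Q → KernelStableAt s B → KernelStableAt s A
  similar⇒stable s {A} {B} {P} {Q} PQ≈1 QP≈1 A≈PBQ stable k v Aᵏv≈0 i = begin
    act A s v i                          ≈⟨ ᵛ*ᴹ-identity (act A s v) i ⟨
    (act A s v ᵛ*ᴹ 1ᴹ) i                 ≈⟨ ᵛ*ᴹ-congˡ (act A s v) PQ≈1 i ⟨
    (act A s v ᵛ*ᴹ (P *ᴹ Q)) i           ≈⟨ ᵛ*ᴹ-assoc (act A s v) P Q i ⟨
    ((act A s v ᵛ*ᴹ P) ᵛ*ᴹ Q) i          ≈⟨ ᵛ*ᴹ-congʳ Q (λ j → trans (intertwine s j) (stable k (v ᵛ*ᴹ P) Bᵏ≈0 j)) i ⟩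
    (0ᵛ ᵛ*ᴹ Q) i                         ≈⟨ 0ᵛ-ᵛ*ᴹ Q i ⟩
    0#                                   ∎
    where
    step : ∀ w → (w ᵛ*ᴹ A) ᵛ*ᴹ P ≈ᵛ (w ᵛ*ᴹ P) ᵛ*ᴹ B
    step w j = begin
      ((w ᵛ*ᴹ A) ᵛ*ᴹ P) j                       ≈⟨ ᵛ*ᴹ-congʳ P (ᵛ*ᴹ-congˡ w A≈PBQ) j ⟩
      ((w ᵛ*ᴹ (P *ᴹ B *ᴹ Q)) ᵛ*ᴹ P) j           ≈⟨ ᵛ*ᴹ-congʳ P (λ j → sym (ᵛ*ᴹ-assoc w (P *ᴹ B) Q j)) j ⟩
      (((w ᵛ*ᴹ (P *ᴹ B)) ᵛ*ᴹ Q) ᵛ*ᴹ P) j        ≈⟨ ᵛ*ᴹ-assoc (w ᵛ*ᴹ (P *ᴹ B)) Q P j ⟩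
      ((w ᵛ*ᴹ (P *ᴹ B)) ᵛ*ᴹ (Q *ᴹ P)) j         ≈⟨ ᵛ*ᴹ-congˡ (w ᵛ*ᴹ (P *ᴹ B)) QP≈1 j ⟩
      ((w ᵛ*ᴹ (P *ᴹ B)) ᵛ*ᴹ 1ᴹ) j               ≈⟨ ᵛ*ᴹ-identity (w ᵛ*ᴹ (P *ᴹ B)) j ⟩
      (w ᵛ*ᴹ (P *ᴹ B)) j                        ≈⟨ ᵛ*ᴹ-assoc w P B j ⟨
      ((w ᵛ*ᴹ P) ᵛ*ᴹ B) j                       ∎
    intertwine : ∀ k → act A k v ᵛ*ᴹ P ≈ᵛ act B k (v ᵛ*ᴹ P)
    intertwine zero    j = refl
    intertwine (suc k) j = trans (step (act A k v) j) (ᵛ*ᴹ-congʳ B (intertwine k) j)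
    Bᵏ≈0 : act B k (v ᵛ*ᴹ P) ≈ᵛ 0ᵛ
    Bᵏ≈0 j = trans (sym (intertwine k j)) (trans (ᵛ*ᴹ-congʳ P Aᵏv≈0 j) (0ᵛ-ᵛ*ᴹ P j))

  open SemiringMult R using () renaming (_×_ to _·_; ×-homo-+ to ·-homo-+)

  occurrences-∷ : ∀ {m} (i d : Fin m) w → occurrences i (d ∷ w) · 1# ≈ 1ᴹ d i + occurrences i w · 1#
  occurrences-∷ i d w with i Fin.≟ d | d Fin.≟ i
  ... | yes _   | yes _   = refl
  ... | no  _   | no  _   = sym (+-identityˡ _)
  ... | yes i≡d | no  d≢i = contradiction (≡.sym i≡d) d≢i
  ... | no  i≢d | yes d≡i = contradiction (≡.sym d≡i) i≢d

  -- Groups the letters of `w` by value. For w = φ(b) the left side is the entry at b of `f` times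
  -- the incidence matrix, so multiplying a row vector by this matrix means summing along the words
  -- φ(b).
  sum-occurrences : ∀ {m} (f : Fin m → Carrier) (w : Word m) →
    sum (λ i → f i * (occurrences i w · 1#)) ≈ foldr (λ d r → f d + r) 0# w
  sum-occurrences f []      = sum-zero _ (λ i → zeroʳ (f i))
  sum-occurrences f (d ∷ w) = begin
    sum (λ i → f i * (occurrences i (d ∷ w) · 1#))                ≈⟨ sum-cong-≋ (λ i → trans (*-congˡ (occurrences-∷ i d w)) (distribˡ (f i) _ _)) ⟩
    sum (λ i → f i * 1ᴹ d i + f i * (occurrences i w · 1#))       ≈⟨ ∑-distrib-+ (λ i → f i * 1ᴹ d i) (λ i → f i * (occurrences i w · 1#)) ⟩
    sum (λ i → f i * 1ᴹ d i) + sum (λ i → f i * (occurrences i w · 1#)) ≈⟨ +-cong (trans (sum-single _ d off) on) (sum-occurrences f w) ⟩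
    f d + foldr (λ d r → f d + r) 0# w                            ∎
    where
    off : ∀ i → i ≢ d → f i * 1ᴹ d i ≈ 0#
    off i i≢d with d Fin.≟ i
    ... | yes d≡i = contradiction (≡.sym d≡i) i≢d
    ... | no  _   = zeroʳ (f i)
    on : f d * 1ᴹ d d ≈ f d
    on with d Fin.≟ d
    ... | yes _   = *-identityʳ (f d)
    ... | no  d≢d = contradiction ≡.refl d≢d

module Jordan {c ℓ₁ ℓ₂} (K : CharZeroField c ℓ₁ ℓ₂) where
  open CharZeroField K
  open Spectral K
  open Matrices semiring
  open VectorMatrix semiring
  open SemiringSum semiring using (sum; sum-cong-≋)
  open SetoidReasoning (Semiring.setoid semiring)

  invertible : ∀ {α} → α # 0# → ∃[ β ] β * α ≈ 1#
  invertible {α} α#0 with #⇒invertible α#0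
  ... | β , β*α≈1 , _ = β , trans (*-congˡ α≈α-0) β*α≈1
    where
    α≈α-0 : α ≈ α - 0#
    α≈α-0 = sym (trans (+-congˡ (RingProperties.-0#≈0# (CommutativeRing.ring (HeytingCommutativeRing.commutativeRing heytingCommutativeRing)))) (+-identityʳ α))

  *-cancelˡ-0 : ∀ {α β} → α # 0# → α * β ≈ 0# → β ≈ 0#
  *-cancelˡ-0 {α} {β} α#0 αβ≈0 with invertible α#0
  ... | γ , γα≈1 = begin
    β              ≈⟨ *-identityˡ β ⟨
    1# * β         ≈⟨ *-congʳ γα≈1 ⟨
    γ * α * β      ≈⟨ *-assoc γ α β ⟩
    γ * (α * β)    ≈⟨ *-congˡ αβ≈0 ⟩
    γ * 0#         ≈⟨ zeroʳ γ ⟩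
    0#             ∎

  module _ (b : JordanBlock) where

    -- The entry of v J in column j is λ v_j + v_{j-1}. Hence the entries of v vanish one after
    -- another, starting from index 0.
    block-injective : eigenvalue b # 0# → ∀ v → v ᵛ*ᴹ blockMatrix b ≈ᵛ 0ᵛ → v ≈ᵛ 0ᵛ
    block-injective λ#0 v vJ≈0 i = below (suc (toℕ i)) i ℕ.≤-refl
      where
      below : ∀ k i → toℕ i < k → v i ≈ 0#
      below (suc k) j (s≤s j≤k) = *-cancelˡ-0 λ#0 (begin
        eigenvalue b * v j               ≈⟨ *-comm _ (v j) ⟩
        v j * eigenvalue b               ≈⟨ *-congˡ diagonal ⟨
        v j * blockMatrix b j j          ≈⟨ sum-single _ j off ⟨
        (v ᵛ*ᴹ blockMatrix b) j          ≈⟨ vJ≈0 j ⟩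
        0#                               ∎)
        where
        diagonal : blockMatrix b j j ≈ eigenvalue b
        diagonal with j Fin.≟ j
        ... | yes _   = refl
        ... | no  j≢j = contradiction ≡.refl j≢j
        off : ∀ i → i ≢ j → v i * blockMatrix b i j ≈ 0#
        off i i≢j with i Fin.≟ j
        ... | yes i≡j = contradiction i≡j i≢j
        ... | no  _ with suc (toℕ i) ℕ.≟ toℕ j
        ...   | yes 1+i≡j = trans (*-congʳ (below k i (≡.subst (_≤ k) (≡.sym 1+i≡j) j≤k))) (zeroˡ _)
        ...   | no  _     = zeroʳ (v i)

    -- With λ = 0 a multiplication by the block shifts a row vector by one place to the right and
    -- puts a zero in front.
    block-nilpotent : eigenvalue b ≈ 0# → ∀ k v i → toℕ i < k → act (blockMatrix b) k v i ≈ 0#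
    block-nilpotent λ≈0 (suc k) v j (s≤s j≤k) = sum-zero _ term
      where
      term : ∀ i → act (blockMatrix b) k v i * blockMatrix b i j ≈ 0#
      term i with i Fin.≟ j
      ... | yes _ = trans (*-congˡ λ≈0) (zeroʳ _)
      ... | no  _ with suc (toℕ i) ℕ.≟ toℕ j
      ...   | yes 1+i≡j = trans (*-congʳ (block-nilpotent λ≈0 k v i (≡.subst (_≤ k) (≡.sym 1+i≡j) j≤k))) (zeroˡ _)
      ...   | no  _     = zeroʳ _

    block-stable : ∀ {s} → (eigenvalue b ≈ 0# → size b ≤ s) → KernelStableAt s (blockMatrix b)
    block-stable {s} size≤s with eigenvalue b #? 0#
    ... | yes λ#0 = injective⇒stable s (blockMatrix b) (block-injective λ#0)
    ... | no ¬λ#0 = λ k v _ i → block-nilpotent λ≈0 s v i (ℕ.<-≤-trans (Fin.toℕ<n i) (size≤s λ≈0))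
      where λ≈0 = proj₁ (tight _ _) ¬λ#0

  module _ (b : JordanBlock) (bs : List JordanBlock) where
    private
      T = totalSize bs
      D = blockDiagonal (b ∷ bs)

    act-↑ˡ : ∀ k v i → act D k v (i ↑ˡ T) ≈ act (blockMatrix b) k (λ i → v (i ↑ˡ T)) i
    act-↑ˡ zero    v j = refl
    act-↑ˡ (suc k) v j = begin
      sum (λ i → act D k v i * D i (j ↑ˡ T))                                     ≈⟨ sum-split (size b) _ ⟩
      sum (λ i → act D k v (i ↑ˡ T) * D (i ↑ˡ T) (j ↑ˡ T)) +
        sum (λ i → act D k v (size b ↑ʳ i) * D (size b ↑ʳ i) (j ↑ˡ T))           ≈⟨ +-cong (sum-cong-≋ (λ i → *-cong (act-↑ˡ k v i) (diagonal i))) (sum-zero _ (λ i → trans (*-congˡ (off i)) (zeroʳ _))) ⟩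
      act (blockMatrix b) (suc k) (λ i → v (i ↑ˡ T)) j + 0#                      ≈⟨ +-identityʳ _ ⟩
      act (blockMatrix b) (suc k) (λ i → v (i ↑ˡ T)) j                           ∎
      where
      diagonal : ∀ i → D (i ↑ˡ T) (j ↑ˡ T) ≈ blockMatrix b i j
      diagonal i rewrite Fin.splitAt-↑ˡ (size b) i T | Fin.splitAt-↑ˡ (size b) j T = refl
      off : ∀ i → D (size b ↑ʳ i) (j ↑ˡ T) ≈ 0#
      off i rewrite Fin.splitAt-↑ʳ (size b) T i | Fin.splitAt-↑ˡ (size b) j T = refl

    act-↑ʳ : ∀ k v i → act D k v (size b ↑ʳ i) ≈ act (blockDiagonal bs) k (λ i → v (size b ↑ʳ i)) i
    act-↑ʳ zero    v j = refl
    act-↑ʳ (suc k) v j = begin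
      sum (λ i → act D k v i * D i (size b ↑ʳ j))                                ≈⟨ sum-split (size b) _ ⟩
      sum (λ i → act D k v (i ↑ˡ T) * D (i ↑ˡ T) (size b ↑ʳ j)) +
        sum (λ i → act D k v (size b ↑ʳ i) * D (size b ↑ʳ i) (size b ↑ʳ j))      ≈⟨ +-cong (sum-zero _ (λ i → trans (*-congˡ (off i)) (zeroʳ _))) (sum-cong-≋ (λ i → *-cong (act-↑ʳ k v i) (diagonal i))) ⟩
      0# + act (blockDiagonal bs) (suc k) (λ i → v (size b ↑ʳ i)) j              ≈⟨ +-identityˡ _ ⟩
      act (blockDiagonal bs) (suc k) (λ i → v (size b ↑ʳ i)) j                   ∎
      where
      diagonal : ∀ i → D (size b ↑ʳ i) (size b ↑ʳ j) ≈ blockDiagonal bs i j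
      diagonal i rewrite Fin.splitAt-↑ʳ (size b) T i | Fin.splitAt-↑ʳ (size b) T j = refl
      off : ∀ i → D (i ↑ˡ T) (size b ↑ʳ j) ≈ 0#
      off i rewrite Fin.splitAt-↑ˡ (size b) i T | Fin.splitAt-↑ʳ (size b) T j = refl

    cons-stable : ∀ {s} → KernelStableAt s (blockMatrix b) → KernelStableAt s (blockDiagonal bs) →
                  KernelStableAt s D
    cons-stable {s} stable-b stable-bs k v Dᵏv≈0 j =
      ≡.subst (λ j → act D s v j ≈ 0#) (Fin.join-splitAt (size b) T j) (cases (splitAt (size b) j))
      where
      cases : ∀ j → act D s v (join (size b) T j) ≈ 0#
      cases (inj₁ i) = trans (act-↑ˡ s v i) (stable-b k _ (λ i → trans (sym (act-↑ˡ k v i)) (Dᵏv≈0 _)) i)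
      cases (inj₂ i) = trans (act-↑ʳ s v i) (stable-bs k _ (λ i → trans (sym (act-↑ʳ k v i)) (Dᵏv≈0 _)) i)

  blockDiagonal-stable : ∀ {s} bs → (∀ {b} → b ∈ bs → eigenvalue b ≈ 0# → size b ≤ s) →
                         KernelStableAt s (blockDiagonal bs)
  blockDiagonal-stable []       _      k v _ ()
  blockDiagonal-stable {s} (b ∷ bs) size≤s = cons-stable b bs {s} (block-stable b {s} (size≤s (here ≡.refl)))
    (blockDiagonal-stable {s} bs (size≤s ∘ there))

  -- Blocks for the eigenvalue 0 have size at most s, so their s-th power vanishes; all other blocks
  -- are injective and add nothing to the generalised kernel.
  jordan-stable : ∀ {n} {A : Matrix n n} (J : JordanForm A) → KernelStableAt (largestBlockSize J 0#) A
  jordan-stable J = similar⇒stable s P*P⁻¹ P⁻¹*P similar (blockDiagonal-stable {s} blocks λ b∈ λ≈0 →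
    All.lookup (xs≤max 0 _) (∈-map⁺ size (∈-filter⁺ (λ b → eigenvalue b ≈? 0#) b∈ λ≈0)))
    where
    open JordanForm J
    s = largestBlockSize J 0#

-- Proportional length vectors and left eigenvectors

Proportional : ∀ {m} → (Fin m → ℕ) → (Fin m → ℕ) → Set
Proportional f g = ∃[ α ] ∃[ β ] 1 ≤ α × ∀ c → α ℕ.* f c ≡ β ℕ.* g c

-- The sequence of functions ℓ abstracts the lengths |φⁿ(b)|.
module Eigenvector {c ℓ₁ ℓ₂} (K : CharZeroField c ℓ₁ ℓ₂) {m : ℕ} (φ : Substitution m) (a : Fin m)
  (ℓ : ℕ → Fin m → ℕ) (ℓ-suc : ∀ n b → ℓ (suc n) b ≡ ℕ.sum (map (ℓ n) (φ b)))
  (ℓ-positive : ∀ n b → 1 ≤ ℓ n b) where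
  open CharZeroField K
  open Spectral K
  open Matrices semiring
  open VectorMatrix semiring
  open Jordan K
  open SetoidReasoning (Semiring.setoid semiring)
  open SemiringMult semiring using (×-homo-+; ×1-homo-*)
  open RingProperties (CommutativeRing.ring (HeytingCommutativeRing.commutativeRing heytingCommutativeRing))
    using (-‿distribˡ-*; +-cancelˡ)

  private
    M : Matrix m m
    M = fromℕᴹ (incidenceMatrix φ)

  fromℕ-positive : ∀ {n} → 1 ≤ n → fromℕ n # 0#
  fromℕ-positive (s≤s {n = n} _) = charZero n

  fromℕ-≉ : ∀ a d → ¬ fromℕ (a ℕ.+ suc d) ≈ fromℕ a
  fromℕ-≉ a d eq = proj₂ (tight _ _) (+-cancelˡ (fromℕ a) _ _ (begin
    fromℕ a + fromℕ (suc d)     ≈⟨ ×-homo-+ 1# a (suc d) ⟨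
    fromℕ (a ℕ.+ suc d)         ≈⟨ eq ⟩
    fromℕ a                     ≈⟨ +-identityʳ _ ⟨
    fromℕ a + 0#                ∎)) (charZero d)

  fromℕ-injective : ∀ {a b} → fromℕ a ≈ fromℕ b → a ≡ b
  fromℕ-injective {a} {b} eq with ℕ.<-cmp a b
  ... | tri≈ _ a≡b _ = a≡b
  ... | tri< a<b _ _ = contradiction
    (≡.subst (λ k → fromℕ k ≈ fromℕ a) (≡.sym (≡.trans (ℕ.+-suc a _) (ℕ.m+[n∸m]≡n a<b))) (sym eq)) (fromℕ-≉ a (b ℕ.∸ suc a))
  ... | tri> _ _ b<a = contradiction
    (≡.subst (λ k → fromℕ k ≈ fromℕ b) (≡.sym (≡.trans (ℕ.+-suc b _) (ℕ.m+[n∸m]≡n b<a))) eq) (fromℕ-≉ b (a ℕ.∸ suc b))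

  L : ℕ → Fin m → Carrier
  L n b = fromℕ (ℓ n b)

  fromℕ-sum : (f : Fin m → ℕ) (w : Word m) →
    foldr (λ d r → fromℕ (f d) + r) 0# w ≈ fromℕ (ℕ.sum (map f w))
  fromℕ-sum f []      = refl
  fromℕ-sum f (d ∷ w) = trans (+-congˡ (fromℕ-sum f w)) (sym (×-homo-+ 1# (f d) _))

  L-suc : ∀ n → L n ᵛ*ᴹ M ≈ᵛ L (suc n)
  L-suc n b = begin
    (L n ᵛ*ᴹ M) b                                      ≈⟨ sum-occurrences (L n) (φ b) ⟩
    foldr (λ d r → L n d + r) 0# (φ b)                 ≈⟨ fromℕ-sum (ℓ n) (φ b) ⟩
    fromℕ (ℕ.sum (map (ℓ n) (φ b)))                    ≡⟨ ≡.cong fromℕ (ℓ-suc n b) ⟨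
    L (suc n) b                                        ∎

  -- Turns a linear relation between ℓₙ₊₁ and ℓₙ into the statement that one vector independent of
  -- n, the same combination of ℓ₁ and ℓ₀, lies in the kernel of Mⁿ.
  act-L : ∀ α β n → act M n (λ b → α * L 1 b + β * L 0 b) ≈ᵛ (λ b → α * L (suc n) b + β * L n b)
  act-L α β zero    b = refl
  act-L α β (suc n) b = begin
    (act M n (λ b → α * L 1 b + β * L 0 b) ᵛ*ᴹ M) b       ≈⟨ ᵛ*ᴹ-congʳ M (act-L α β n) b ⟩
    ((λ b → α * L (suc n) b + β * L n b) ᵛ*ᴹ M) b         ≈⟨ ᵛ*ᴹ-linear α β (L (suc n)) (L n) M b ⟩
    α * (L (suc n) ᵛ*ᴹ M) b + β * (L n ᵛ*ᴹ M) b           ≈⟨ +-cong (*-congˡ (L-suc (suc n) b)) (*-congˡ (L-suc n b)) ⟩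
    α * L (suc (suc n)) b + β * L (suc n) b               ∎

  module _ (J : JordanForm M) where
    private s = largestBlockSize J 0#

    -- The vector g ℓ₁ - p ℓ₀ is annihilated by Mⁿ, hence already by Mˢ. This says that g ℓₛ₊₁ = p
    -- ℓₛ, so the eigenvalue is p / g.
    proportional⇒eigenvector : ∃[ n ] Proportional (ℓ (suc n)) (ℓ n) → IsLeftEigenvector (L s) M
    proportional⇒eigenvector (n , g , p , 1≤g , eq) = nonzero , γ * fromℕ p , λ b → begin
        (L s ᵛ*ᴹ M) b                             ≈⟨ L-suc s b ⟩
        L (suc s) b                               ≈⟨ *-identityˡ _ ⟨
        1# * L (suc s) b                          ≈⟨ *-congʳ γg≈1 ⟨
        γ * fromℕ g * L (suc s) b                 ≈⟨ *-assoc γ _ _ ⟩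
        γ * (fromℕ g * L (suc s) b)               ≈⟨ *-congˡ (difference-zero (trans (sym (act-L (fromℕ g) (- fromℕ p) s b)) (jordan-stable J n _ vanishes b))) ⟩
        γ * (fromℕ p * L s b)                     ≈⟨ *-assoc γ _ _ ⟨
        γ * fromℕ p * L s b                       ∎
      where
      γ = proj₁ (invertible (fromℕ-positive 1≤g))
      γg≈1 = proj₂ (invertible (fromℕ-positive 1≤g))
      nonzero : ¬ (∀ b → L s b ≈ 0#)
      nonzero L≈0 = proj₂ (tight _ _) (L≈0 a) (fromℕ-positive (ℓ-positive s a))
      difference-zero : ∀ {u v α} → u + (- α) * v ≈ 0# → u ≈ α * v
      difference-zero {u} {v} {α} eq = begin
        u                                ≈⟨ +-identityʳ u ⟨
        u + 0#                           ≈⟨ +-congˡ (-‿inverseˡ (α * v)) ⟨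
        u + (- (α * v) + α * v)          ≈⟨ +-assoc u _ _ ⟨
        u + - (α * v) + α * v            ≈⟨ +-congʳ (+-congˡ (-‿distribˡ-* α v)) ⟩
        u + (- α) * v + α * v            ≈⟨ +-congʳ eq ⟩
        0# + α * v                       ≈⟨ +-identityˡ _ ⟩
        α * v                            ∎
      vanishes : act M n (λ b → fromℕ g * L 1 b + (- fromℕ p) * L 0 b) ≈ᵛ 0ᵛ
      vanishes b = begin
        act M n (λ b → fromℕ g * L 1 b + (- fromℕ p) * L 0 b) b   ≈⟨ act-L (fromℕ g) (- fromℕ p) n b ⟩
        fromℕ g * L (suc n) b + (- fromℕ p) * L n b               ≈⟨ +-cong (×1-homo-* g (ℓ (suc n) b)) (-‿distribˡ-* (fromℕ p) (L n b)) ⟨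
        fromℕ (g ℕ.* ℓ (suc n) b) + - (fromℕ p * L n b)           ≈⟨ +-cong (reflexive (≡.cong fromℕ (eq b))) (-‿cong (sym (×1-homo-* p (ℓ n b)))) ⟩
        fromℕ (p ℕ.* ℓ n b) + - fromℕ (p ℕ.* ℓ n b)               ≈⟨ -‿inverseʳ _ ⟩
        0#                                                        ∎

  -- The eigenvalue μ is only an element of the field. Comparing the entries at b and at `a`
  -- eliminates it and leaves an identity between natural numbers.
  eigenvector⇒proportional : ∀ {n} → IsLeftEigenvector (L n) M → Proportional (ℓ (suc n)) (ℓ n)
  eigenvector⇒proportional {n} (_ , μ , eq) = ℓ n a , ℓ (suc n) a , ℓ-positive n a , λ b →
    fromℕ-injective (begin
      fromℕ (ℓ n a ℕ.* ℓ (suc n) b)    ≈⟨ ×1-homo-* (ℓ n a) _ ⟩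
      L n a * L (suc n) b              ≈⟨ *-congˡ (eigen b) ⟩
      L n a * (μ * L n b)              ≈⟨ *-assoc _ μ _ ⟨
      L n a * μ * L n b                ≈⟨ *-congʳ (*-comm _ μ) ⟩
      μ * L n a * L n b                ≈⟨ *-congʳ (eigen a) ⟨
      L (suc n) a * L n b              ≈⟨ ×1-homo-* (ℓ (suc n) a) _ ⟨
      fromℕ (ℓ (suc n) a ℕ.* ℓ n b)    ∎)
    where
    eigen : ∀ b → L (suc n) b ≈ μ * L n b
    eigen b = trans (sym (L-suc n b)) (eq b)

-- Words, sequences and lengths

open import Data.Nat
open import Data.Nat.Coprimality using (Coprime; coprime-/gcd; coprime-divisor)
open import Data.Nat.Divisibility
open import Data.Nat.DivMod
open import Data.Nat.GCD using (gcd; gcd[m,n]∣m; gcd[m,n]∣n; gcd[m,n]≢0)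
open import Data.Nat.GeneralisedArithmetic using (fold-+)
open import Data.Nat.Induction using (<-wellFounded)
open import Data.Nat.ListAction using (sum)
open import Data.Nat.Properties
open import Induction.WellFounded using (Acc; acc)
open import Relation.Binary.PropositionalEquality hiding ([_])
open CommutativeSemigroupProperties *-commutativeSemigroup using (x∙yz≈y∙xz; x∙yz≈z∙yx; xy∙z≈xz∙y)
open Matrices +-*-semiring using (_^ᴹ_)
open SemiringSum +-*-semiring using () renaming (sum to sumᶠ)
open OneSided using (Seq; prefix; Periodic; Automatic)
open TwoSided using (left; right)

private variable
  A B : Set
  m n : ℕ

infix 4 _≼_
_≼_ : List A → Seq A → Set
w ≼ z = prefix z (length w) ≡ w

prefix-+ : (z : Seq A) (i j : ℕ) → prefix z (i + j) ≡ prefix z i ++ prefix (λ e → z (i + e)) j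
prefix-+ z zero    j = refl
prefix-+ z (suc i) j = cong (z 0 ∷_) (prefix-+ (z ∘ suc) i j)

prefix-suc : (z : Seq A) (i : ℕ) → prefix z (suc i) ≡ prefix z i ++ [ z i ]
prefix-suc z i = sym (applyUpTo-∷ʳ z i)

prefix-cong : {y z : Seq A} → (∀ i → y i ≡ z i) → ∀ n → prefix y n ≡ prefix z n
prefix-cong eq zero    = refl
prefix-cong eq (suc n) = cong₂ _∷_ (eq 0) (prefix-cong (eq ∘ suc) n)

prefix-injective : {y z : Seq A} (n : ℕ) → prefix y n ≡ prefix z n → ∀ {i} → i < n → y i ≡ z i
prefix-injective (suc n) eq {zero}  i<n = ∷-injectiveˡ eq
prefix-injective (suc n) eq {suc i} i<n = prefix-injective n (∷-injectiveʳ eq) (s<s⁻¹ i<n)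

≼-refl : (z : Seq A) (n : ℕ) → prefix z n ≼ z
≼-refl z n = cong (prefix z) (length-applyUpTo z n)

++-≼⁻ʳ : (u : List A) {v : List A} {z : Seq A} → u ≼ z → (u ++ v) ≼ z → v ≼ (λ e → z (length u + e))
++-≼⁻ʳ u {v} {z} p q = ++-cancelˡ u (prefix (λ e → z (length u + e)) (length v)) v
  (trans (cong (_++ prefix (λ e → z (length u + e)) (length v)) (sym p))
  (trans (sym (prefix-+ z (length u) (length v)))
  (trans (cong (prefix z) (sym (length-++ u))) q)))

≼-agree : {u : List A} {y z : Seq A} → u ≼ y → u ≼ z → ∀ {i} → i < length u → y i ≡ z i
≼-agree {u = u} p q = prefix-injective (length u) (trans p (sym q))

1≤⇒NonZero : ∀ {n} → 1 ≤ n → NonZero n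
1≤⇒NonZero (s≤s _) = _

m≤k*m : ∀ {k} m → 1 ≤ k → m ≤ k * m
m≤k*m {suc k} m _ = m≤m+n m (k * m)

Fin-bounded : (f : Fin m → ℕ) → ∃[ K ] ∀ b → f b ≤ K
Fin-bounded {zero}  f = 0 , λ ()
Fin-bounded {suc m} f with Fin-bounded (f ∘ suc)
... | K , f≤K = f zero + K , λ where
  zero    → m≤m+n (f zero) K
  (suc b) → m≤n⇒m≤o+n (f zero) (f≤K b)

length-concatMap-≥ : {f : A → List B} → (∀ c → 1 ≤ length (f c)) → ∀ w → length w ≤ length (concatMap f w)
length-concatMap-≥ nonerasing []              = z≤n
length-concatMap-≥ {f = f} nonerasing (c ∷ w) = subst (suc (length w) ≤_) (sym (length-++ (f c)))
  (+-mono-≤ (nonerasing c) (length-concatMap-≥ nonerasing w))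

-- Selects the scale that fits a given size. It is applied to the lengths |φᵏ(a)| and to the powers
-- of `k`.
crossing : (f : ℕ → ℕ) {v : ℕ} (T : ℕ) → f 0 ≤ v → v < f T → ∃[ j ] f j ≤ v × v < f (suc j)
crossing f zero    f₀≤v v<f = contradiction f₀≤v (<⇒≱ v<f)
crossing f {v} (suc T) f₀≤v v<f with v <? f T
... | yes v<fT = crossing f T f₀≤v v<fT
... | no  v≮fT = T , ≮⇒≥ v≮fT , v<f

n<k^n : ∀ {k} → 2 ≤ k → ∀ n → n < k ^ n
n<k^n 2≤k zero    = s≤s z≤n
n<k^n {k} 2≤k (suc n) = begin
  suc (suc n)     ≤⟨ s≤s (n<k^n 2≤k n) ⟩
  1 + k ^ n       ≤⟨ +-monoˡ-≤ (k ^ n) (≤-trans (s≤s z≤n) (n<k^n 2≤k n)) ⟩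
  k ^ n + k ^ n   ≡⟨ cong (k ^ n +_) (+-identityʳ _) ⟨
  2 * k ^ n       ≤⟨ *-monoˡ-≤ (k ^ n) 2≤k ⟩
  k ^ suc n       ∎
  where open ≤-Reasoning

module Lengths (φ : Substitution m) where

  iterate-++ : ∀ n u v → iterateSubst φ n (u ++ v) ≡ iterateSubst φ n u ++ iterateSubst φ n v
  iterate-++ zero    u v = refl
  iterate-++ (suc n) u v = trans (cong (concatMap φ) (iterate-++ n u v))
    (concatMap-++ φ (iterateSubst φ n u) (iterateSubst φ n v))

  iterate-+ : ∀ n k w → iterateSubst φ (n + k) w ≡ iterateSubst φ n (iterateSubst φ k w)
  iterate-+ n k w = fold-+ w (concatMap φ) n

  iterate-[] : ∀ n → iterateSubst φ n [] ≡ []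
  iterate-[] zero    = refl
  iterate-[] (suc n) = cong (concatMap φ) (iterate-[] n)

  ℓ : ℕ → Fin m → ℕ
  ℓ n b = length (iterateSubst φ n [ b ])

  length-iterate : ∀ n w → length (iterateSubst φ n w) ≡ sum (map (ℓ n) w)
  length-iterate n []      = cong length (iterate-[] n)
  length-iterate n (b ∷ w) = trans (cong length (iterate-++ n [ b ] w))
    (trans (length-++ (iterateSubst φ n [ b ])) (cong (ℓ n b +_) (length-iterate n w)))

  ℓ-+ : ∀ n k b → ℓ (n + k) b ≡ sum (map (ℓ n) (iterateSubst φ k [ b ]))
  ℓ-+ n k b = trans (cong length (iterate-+ n k [ b ])) (length-iterate n (iterateSubst φ k [ b ]))

  ℓ-suc : ∀ n b → ℓ (suc n) b ≡ sum (map (ℓ n) (φ b))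
  ℓ-suc n b = trans (cong (λ k → ℓ k b) (+-comm 1 n))
    (trans (ℓ-+ n 1 b) (cong (sum ∘ map (ℓ n)) (++-identityʳ (φ b))))

  ℓ-∈ : ∀ n k {b c} → c ∈ iterateSubst φ k [ b ] → ℓ n c ≤ ℓ (n + k) b
  ℓ-∈ n k {b} {c} c∈ = subst (ℓ n c ≤_) (sym (ℓ-+ n k b)) (le c∈)
    where
    le : ∀ {w} → c ∈ w → ℓ n c ≤ sum (map (ℓ n) w)
    le (here refl) = m≤m+n _ _
    le {d ∷ _} (there c∈) = m≤n⇒m≤o+n (ℓ n d) (le c∈)

  module _ (nonerasing : ∀ b → 1 ≤ length (φ b)) where

    ℓ-mono : ∀ {n k} b → n ≤ k → ℓ n b ≤ ℓ k b
    ℓ-mono b n≤k = go (≤⇒≤′ n≤k)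
      where
      go : ∀ {n k} → n ≤′ k → ℓ n b ≤ ℓ k b
      go ≤′-refl = ≤-refl
      go (≤′-step {k} p) = ≤-trans (go p) (length-concatMap-≥ nonerasing (iterateSubst φ k [ b ]))

    ℓ-positive : ∀ n b → 1 ≤ ℓ n b
    ℓ-positive n b = ℓ-mono {0} {n} b z≤n

  module _ {K : ℕ} (bound : ∀ b → length (φ b) ≤ K) where

    length-concatMap-≤ : ∀ w → length (concatMap φ w) ≤ K * length w
    length-concatMap-≤ []      = z≤n
    length-concatMap-≤ (b ∷ w) = subst₂ _≤_ (sym (length-++ (φ b))) (sym (*-suc K (length w)))
      (+-mono-≤ (bound b) (length-concatMap-≤ w))

    ℓ-+-≤ : ∀ k n b → ℓ (k + n) b ≤ K ^ k * ℓ n b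
    ℓ-+-≤ zero    n b = ≤-reflexive (sym (*-identityˡ _))
    ℓ-+-≤ (suc k) n b = ≤-trans (length-concatMap-≤ (iterateSubst φ (k + n) [ b ]))
      (subst (K * ℓ (k + n) b ≤_) (sym (*-assoc K (K ^ k) _)) (*-monoʳ-≤ K (ℓ-+-≤ k n b)))

module FixedPoint (φ : Substitution m) (x : Seq (Fin m))
                  (fixed : ∀ n → concatMap φ (prefix x n) ≼ x) where
  open Lengths φ public

  -- The position in x at which the block φⁿ(x_i) begins; the values of `P n` are the cutting points
  -- of level n.
  P : ℕ → ℕ → ℕ
  P n i = length (iterateSubst φ n (prefix x i))

  P-zero : ∀ n → P n 0 ≡ 0
  P-zero n = cong length (iterate-[] n)

  P-suc : ∀ n i → P n (suc i) ≡ P n i + ℓ n (x i)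
  P-suc n i = trans (cong (length ∘ iterateSubst φ n) (prefix-suc x i))
    (trans (cong length (iterate-++ n (prefix x i) [ x i ])) (length-++ (iterateSubst φ n (prefix x i))))

  P-one : ∀ n → P n 1 ≡ ℓ n (x 0)
  P-one n = trans (P-suc n 0) (cong (_+ ℓ n (x 0)) (P-zero n))

  P-mono : ∀ n {i j} → i ≤ j → P n i ≤ P n j
  P-mono n i≤j = go (≤⇒≤′ i≤j)
    where
    go : ∀ {i j} → i ≤′ j → P n i ≤ P n j
    go ≤′-refl = ≤-refl
    go (≤′-step {j} p) = ≤-trans (go p) (subst (P n j ≤_) (sym (P-suc n j)) (m≤m+n _ _))

  iterate-≼ : ∀ n i → iterateSubst φ n (prefix x i) ≼ x
  iterate-≼ zero    i = ≼-refl x i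
  iterate-≼ (suc n) i = subst (λ w → concatMap φ w ≼ x) (iterate-≼ n i) (fixed (P n i))

  -- The image of a prefix of x under φᵏ is again a prefix of x, so every cutting point of level n +
  -- k is also one of level n.
  P-+ : ∀ n k i → P (n + k) i ≡ P n (P k i)
  P-+ n k i = cong length (trans (iterate-+ n k (prefix x i))
    (cong (iterateSubst φ n) (sym (iterate-≼ k i))))

  block-≼ : ∀ n i → iterateSubst φ n [ x i ] ≼ (λ e → x (P n i + e))
  block-≼ n i = ++-≼⁻ʳ (iterateSubst φ n (prefix x i)) (iterate-≼ n i)
    (subst (_≼ x) (trans (cong (iterateSubst φ n) (prefix-suc x i)) (iterate-++ n (prefix x i) [ x i ]))
      (iterate-≼ n (suc i)))

  same-block : ∀ n {i j} → x i ≡ x j → ∀ {e} → e < ℓ n (x i) → x (P n i + e) ≡ x (P n j + e)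
  same-block n {i} {j} eq = ≼-agree (block-≼ n i)
    (subst (λ b → iterateSubst φ n [ b ] ≼ (λ e → x (P n j + e))) (sym eq) (block-≼ n j))

  -- Where x repeats its prefix of length `e`, the block lengths of every level repeat as well, so
  -- the cutting points are translated copies of the initial ones.
  P-shift : ∀ n i e → (∀ {e′} → e′ < e → x (i + e′) ≡ x e′) → P n (i + e) ≡ P n i + P n e
  P-shift n i zero    _  = trans (cong (P n) (+-identityʳ i))
    (sym (trans (cong (P n i +_) (P-zero n)) (+-identityʳ _)))
  P-shift n i (suc e) eq = begin
    P n (i + suc e)                  ≡⟨ cong (P n) (+-suc i e) ⟩
    P n (suc (i + e))                ≡⟨ P-suc n (i + e) ⟩
    P n (i + e) + ℓ n (x (i + e))    ≡⟨ cong₂ _+_ (P-shift n i e (eq ∘ m<n⇒m<1+n)) (cong (ℓ n) (eq ≤-refl)) ⟩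
    P n i + P n e + ℓ n (x e)        ≡⟨ +-assoc (P n i) _ _ ⟩
    P n i + (P n e + ℓ n (x e))      ≡⟨ cong (P n i +_) (P-suc n e) ⟨
    P n i + P n (suc e)              ∎
    where open ≡-Reasoning

  module _ (nonerasing : ∀ b → 1 ≤ length (φ b)) where

    locate : ∀ n s → ∃[ i ] ∃[ e ] e < ℓ n (x i) × s ≡ P n i + e
    locate n zero = 0 , 0 , ℓ-positive nonerasing n (x 0) , sym (trans (+-identityʳ _) (P-zero n))
    locate n (suc s) with locate n s
    ... | i , e , e<ℓ , refl with suc e <? ℓ n (x i)
    ... | yes e+1<ℓ = i , suc e , e+1<ℓ , sym (+-suc (P n i) e)
    ... | no  e+1≮ℓ = suc i , 0 , ℓ-positive nonerasing n (x (suc i)) , (begin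
      suc (P n i + e)      ≡⟨ +-suc (P n i) e ⟨
      P n i + suc e        ≡⟨ cong (P n i +_) (≤-antisym e<ℓ (≮⇒≥ e+1≮ℓ)) ⟩
      P n i + ℓ n (x i)    ≡⟨ P-suc n i ⟨
      P n (suc i)          ≡⟨ +-identityʳ _ ⟨
      P n (suc i) + 0      ∎)
      where open ≡-Reasoning

  module _ {a : Fin m} (proper : ∀ b → ∃[ w ] φ b ≡ a ∷ w) where

    first-letter : ∀ i → x (P 1 i) ≡ a
    first-letter i with proper (x i)
    ... | w , eq = trans (cong x (sym (+-identityʳ (P 1 i))))
      (head≡ {z = λ e → x (P 1 i + e)} (subst (λ u → (u ++ []) ≼ (λ e → x (P 1 i + e))) eq (block-≼ 1 i)))
      where
      head≡ : ∀ {u} {z : Seq (Fin m)} → (a ∷ u) ≼ z → z 0 ≡ a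
      head≡ = ∷-injectiveˡ

    x₀≡a : x 0 ≡ a
    x₀≡a = first-letter 0

    -- Since φ(x_i) begins with a, the block φⁿ⁺¹(x_i) begins with φⁿ(a), and this word is a prefix
    -- of x because x_0 = a.
    block-start : ∀ n i {e} → e < ℓ n a → x (P (suc n) i + e) ≡ x e
    block-start n i {e} e<ℓ = begin
      x (P (suc n) i + e)     ≡⟨ cong (λ k → x (P k i + e)) (+-comm 1 n) ⟩
      x (P (n + 1) i + e)     ≡⟨ cong (λ k → x (k + e)) (P-+ n 1 i) ⟩
      x (P n (P 1 i) + e)     ≡⟨ same-block n (trans (first-letter i) (sym x₀≡a))
                                   (subst (λ b → e < ℓ n b) (sym (first-letter i)) e<ℓ) ⟩
      x (P n 0 + e)           ≡⟨ cong (λ k → x (k + e)) (P-zero n) ⟩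
      x e                     ∎
      where open ≡-Reasoning

    -- Whatever the next letter is, a block of level n + 1 is followed by φⁿ(a), so equal letters
    -- determine that much beyond their own block.
    extended-block : ∀ n {i j} → x i ≡ x j → ∀ {e} → e < ℓ (suc n) (x i) + ℓ n a →
                     x (P (suc n) i + e) ≡ x (P (suc n) j + e)
    extended-block n {i} {j} eq {e} e<  with e <? ℓ (suc n) (x i)
    ... | yes e<ℓ = same-block (suc n) eq e<ℓ
    ... | no  e≮ℓ = subst (λ e → x (P (suc n) i + e) ≡ x (P (suc n) j + e)) (m+[n∸m]≡n (≮⇒≥ e≮ℓ))
                      (trans (next i refl) (sym (next j (cong (ℓ (suc n)) eq))))
      where
      d = e ∸ ℓ (suc n) (x i)
      next : ∀ k → ℓ (suc n) (x i) ≡ ℓ (suc n) (x k) → x (P (suc n) k + (ℓ (suc n) (x i) + d)) ≡ x d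
      next k ℓ≡ = trans (cong x (begin
        P (suc n) k + (ℓ (suc n) (x i) + d)    ≡⟨ +-assoc (P (suc n) k) _ d ⟨
        P (suc n) k + ℓ (suc n) (x i) + d      ≡⟨ cong (λ r → P (suc n) k + r + d) ℓ≡ ⟩
        P (suc n) k + ℓ (suc n) (x k) + d      ≡⟨ cong (_+ d) (P-suc (suc n) k) ⟨
        P (suc n) (suc k) + d                  ∎))
        (block-start n (suc k) (+-cancelˡ-< (ℓ (suc n) (x i)) _ _
          (subst (_< ℓ (suc n) (x i) + ℓ n a) (sym (m+[n∸m]≡n (≮⇒≥ e≮ℓ))) e<)))
        where open ≡-Reasoning

-- Primitivity, growth and recurrence

0<sum⇒∃ : (f : Fin m → ℕ) → 0 < sumᶠ f → ∃[ i ] 0 < f i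
0<sum⇒∃ {suc m} f 0<s with f zero in eq
... | suc _ = zero , subst (0 <_) (sym eq) (s≤s z≤n)
... | zero  with 0<sum⇒∃ (f ∘ suc) 0<s
...   | i , 0<fi = suc i , 0<fi

0<m*n⇒0<m×0<n : ∀ m n → 0 < m * n → 0 < m × 0 < n
0<m*n⇒0<m×0<n (suc m) (suc n) _ = s≤s z≤n , s≤s z≤n
0<m*n⇒0<m×0<n (suc m) zero 0<0 = contradiction (subst (0 <_) (*-zeroʳ m) 0<0) λ ()

0<occurrences⇒∈ : (c : Fin m) (w : Word m) → 0 < occurrences c w → c ∈ w
0<occurrences⇒∈ c (b ∷ w) 0<o with c Fin.≟ b
... | yes c≡b = here c≡b
... | no  _   = there (0<occurrences⇒∈ c w 0<o)

∈⇒1≤length : {A : Set} {c : A} {w : List A} → c ∈ w → 1 ≤ length w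
∈⇒1≤length {w = _ ∷ _} _ = s≤s z≤n

∈-≼ : {A : Set} {b : A} {w : List A} {z : Seq A} → w ≼ z → b ∈ w → ∃[ i ] i < length w × z i ≡ b
∈-≼ w≼z (here refl) = 0 , s≤s z≤n , ∷-injectiveˡ w≼z
∈-≼ {z = z} w≼z (there b∈w) with ∈-≼ {z = z ∘ suc} (∷-injectiveʳ w≼z) b∈w
... | i , i< , eq = suc i , s≤s i< , eq

two-letters⇒2≤length : {A : Set} {c d : A} {w : List A} → c ≢ d → c ∈ w → d ∈ w → 2 ≤ length w
two-letters⇒2≤length c≢d (here refl) (here refl) = contradiction refl c≢d
two-letters⇒2≤length c≢d (here _)  (there q) = s≤s (∈⇒1≤length q)
two-letters⇒2≤length c≢d (there p) _         = s≤s (∈⇒1≤length p)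

Distinct : ℕ → Set
Distinct m = ∃[ c ] ∃[ d ] _≢_ {A = Fin m} c d

-- Over a single letter every sequence is constant. In a larger alphabet any two letters will do, so
-- it need not be decided which letters occur in `x`.
distinct-letters : {I : Set} (x : I → Fin m) → I → ¬ (∀ i j → x i ≡ x j) → Distinct m
distinct-letters {zero} x i _ = contradiction (x i) λ ()
distinct-letters {suc zero} x i nonconstant = contradiction (λ i j → all≡ (x i) (x j)) nonconstant
  where
  all≡ : (b c : Fin 1) → b ≡ c
  all≡ zero zero = refl
distinct-letters {suc (suc m)} x i _ = zero , suc zero , λ ()

module Primitivity (φ : Substitution m) where
  open Lengths φ

  ∈-iterate : ∀ n {b c} {w : Word m} → c ∈ w → b ∈ iterateSubst φ n [ c ] → b ∈ iterateSubst φ n w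
  ∈-iterate n {b} {c} {w = _ ∷ w} (here refl) b∈ =
    subst (b ∈_) (sym (iterate-++ n [ c ] w)) (∈-++⁺ˡ b∈)
  ∈-iterate n {b} {w = d ∷ w} (there c∈w) b∈ =
    subst (b ∈_) (sym (iterate-++ n [ d ] w)) (∈-++⁺ʳ (iterateSubst φ n [ d ]) (∈-iterate n c∈w b∈))

  ∈-substitute : ∀ {b c} {w : Word m} → c ∈ w → b ∈ φ c → b ∈ concatMap φ w
  ∈-substitute {b} {c} c∈w b∈ = ∈-iterate 1 c∈w (subst (b ∈_) (sym (++-identityʳ (φ c))) b∈)

  0<M^n⇒∈ : ∀ n {c b} → 0 < (incidenceMatrix φ ^ᴹ n) c b → c ∈ iterateSubst φ n [ b ]
  0<M^n⇒∈ zero {c} {b} 0<M with c Fin.≟ b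
  ... | yes c≡b = here c≡b
  0<M^n⇒∈ (suc n) {c} {b} 0<M with 0<sum⇒∃ _ 0<M
  ... | j , 0<p with 0<m*n⇒0<m×0<n (incidenceMatrix φ c j) _ 0<p
  ... | 0<c , 0<j = ∈-substitute (0<M^n⇒∈ n 0<j) (0<occurrences⇒∈ c (φ j) 0<c)

record ProperPrimitive (φ : Substitution m) : Set where
  field
    initial    : Fin m
    proper     : ∀ b → ∃[ w ] φ b ≡ initial ∷ w
    exponent   : ℕ
    full       : ∀ c b → c ∈ iterateSubst φ exponent [ b ]

properPrimitive : (φ : Substitution m) → Primitive φ → LeftProper φ → ProperPrimitive φ
properPrimitive φ (N , _ , M^N>0) (a , proper) = record
  { initial = a ; proper = proper ; exponent = N
  ; full = λ c b → Primitivity.0<M^n⇒∈ φ N (M^N>0 c b) }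

module Growth {φ : Substitution m} (pp : ProperPrimitive φ) where
  open ProperPrimitive pp renaming (initial to a; exponent to N) public
  open Lengths φ public
  open Primitivity φ public

  nonerasing : ∀ b → 1 ≤ length (φ b)
  nonerasing b with proper b
  ... | w , eq = subst (1 ≤_) (cong length (sym eq)) (s≤s z≤n)

  ℓ-≤-shift : ∀ n b c → ℓ n b ≤ ℓ (n + N) c
  ℓ-≤-shift n b c = ℓ-∈ n N (full b c)

  full-beyond : ∀ {D} → N ≤ D → ∀ c b → c ∈ iterateSubst φ D [ b ]
  full-beyond {D} N≤D c b = subst (c ∈_) (sym (trans (cong (λ k → iterateSubst φ k [ b ])
    (sym (m+[n∸m]≡n N≤D))) (iterate-+ N (D ∸ N) [ b ]))) (nonempty (iterateSubst φ (D ∸ N) [ b ])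
      (ℓ-positive nonerasing (D ∸ N) b))
    where
    nonempty : ∀ w → 1 ≤ length w → c ∈ iterateSubst φ N w
    nonempty (d ∷ w) _ = ∈-iterate N {w = d ∷ w} (here refl) (full c d)

  -- Each word φᴺ(b) has at least two letters, so N further levels add at least one to the smallest
  -- length.
  growth : Distinct m → ∀ D → ∃[ n ] ∀ b → D ≤ ℓ n b
  growth _ zero = 0 , λ _ → z≤n
  growth (c , d , c≢d) (suc D) with growth (c , d , c≢d) D
  ... | n , D≤ℓ = n + N , λ b → subst (suc D ≤_) (sym (ℓ-+ n N b))
    (go (iterateSubst φ N [ b ]) (two-letters⇒2≤length c≢d (full c b) (full d b)))
    where
    go : ∀ w → 2 ≤ length w → suc D ≤ sum (map (ℓ n) w)
    go (b ∷ []) (s≤s ())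
    go (b ∷ b′ ∷ w) _ = subst (_≤ sum (map (ℓ n) (b ∷ b′ ∷ w))) (+-comm D 1)
      (+-mono-≤ (D≤ℓ b) (≤-trans (ℓ-positive nonerasing n b′) (m≤m+n _ _)))

module Recurrence {φ : Substitution m} (pp : ProperPrimitive φ)
                  (x : Seq (Fin m)) (fixed : ∀ n → concatMap φ (prefix x n) ≼ x) where
  open Growth pp public
  open FixedPoint φ x fixed public using (P; P-zero; P-suc; P-one; P-mono; P-+; P-shift; extended-block; x₀≡a; block-start; locate)

  -- The sequence begins with φᴺ(a), a word that contains every letter.
  find-letter : ∀ b → ∃[ i ] i < ℓ N a × x i ≡ b
  find-letter b = subst (λ c → ∃[ i ] i < ℓ N c × x i ≡ b) (x₀≡a proper)
    (∈-≼ (FixedPoint.iterate-≼ φ x fixed N 1) (full b (x 0)))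

  module _ {K : ℕ} (bound : ∀ b → length (φ b) ≤ K) (distinct : Distinct m) where

    -- For |φᵏ(a)| ≤ K d, a prefix of length at most K^(N+2) d contains all blocks φᵏ⁺¹(b); the
    -- summand 1 leaves room for d more positions.
    recurrenceConstant : ℕ
    recurrenceConstant = suc (K ^ suc (suc N))

    -- The letters before position |φᴺ(a)| spell φᴺ(a), so the left side is |φⁿ⁺¹⁺ᴺ(a)|, and each
    -- level multiplies lengths by at most `K`.
    P-bound : ∀ n → P (suc n) (ℓ N a) ≤ K ^ suc N * ℓ n a
    P-bound n = subst (_≤ K ^ suc N * ℓ n a) (begin
      ℓ (suc N + n) a          ≡⟨ cong₂ ℓ (cong suc (+-comm N n)) (sym (x₀≡a proper)) ⟩
      ℓ (suc n + N) (x 0)      ≡⟨ P-one (suc n + N) ⟨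
      P (suc n + N) 1          ≡⟨ P-+ (suc n) N 1 ⟩
      P (suc n) (P N 1)        ≡⟨ cong (P (suc n)) (trans (P-one N) (cong (ℓ N) (x₀≡a proper))) ⟩
      P (suc n) (ℓ N a)        ∎) (ℓ-+-≤ bound (suc N) n a)
      where open ≡-Reasoning

    -- If d ≤ |φⁿ(a)|, every factor of length d + 1 of x lies in some φⁿ⁺¹(b)φⁿ(a), and
    -- hence occurs in the prefix of length comparable to d that contains every block φⁿ⁺¹(b).
    period-of-prefix : {B : Set} (τ : Fin m → B) {d L : ℕ} → 1 ≤ d → d * recurrenceConstant ≤ L →
      (∀ s → s + d < L → τ (x (s + d)) ≡ τ (x s)) → ∀ s → τ (x (s + d)) ≡ τ (x s)
    period-of-prefix τ {d} {L} 1≤d dM≤L periodic s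
      with growth distinct (suc d)
    -- The level k = k′ + 1 is the one at which |φᵏ(a)| first passes d: it exceeds d, so extended
    -- blocks are long enough, but is at most K d. The crossing starts from |φ⁰(a)| = 1 ≤ d.
    ... | T , d<ℓT with crossing (λ k → ℓ k a) T 1≤d (d<ℓT a)
    ... | k′ , ℓ≤d , d<ℓ with locate nonerasing (suc (suc k′)) s
    ... | i , e , e<ℓ , refl with find-letter (x i)
    ... | j , j<F , xj≡xi = let open ≡-Reasoning in begin
      τ (x (P k+1 i + e + d))    ≡⟨ cong (τ ∘ x) (+-assoc (P k+1 i) e d) ⟩
      τ (x (P k+1 i + (e + d)))  ≡⟨ cong τ (extended-block proper k (sym xj≡xi) (+-mono-<-≤ e<ℓ (<⇒≤ d<ℓ))) ⟩
      τ (x (P k+1 j + (e + d)))  ≡⟨ cong (τ ∘ x) (+-assoc (P k+1 j) e d) ⟨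
      τ (x (P k+1 j + e + d))    ≡⟨ periodic (P k+1 j + e) in-prefix ⟩
      τ (x (P k+1 j + e))        ≡⟨ cong τ (extended-block proper k (sym xj≡xi) (≤-trans e<ℓ (m≤m+n _ _))) ⟨
      τ (x (P k+1 i + e))        ∎
      where
      k = suc k′
      k+1 = suc k
      ℓk≤Kd : ℓ k a ≤ K * d
      ℓk≤Kd = ≤-trans (length-concatMap-≤ bound (iterateSubst φ k′ [ a ])) (*-monoʳ-≤ K ℓ≤d)
      in-prefix : P k+1 j + e + d < L
      in-prefix = begin-strict
        P k+1 j + e + d                 <⟨ +-monoˡ-< d (+-monoʳ-< (P k+1 j) (subst (λ b → e < ℓ k+1 b) (sym xj≡xi) e<ℓ)) ⟩
        P k+1 j + ℓ k+1 (x j) + d       ≡⟨ cong (_+ d) (P-suc k+1 j) ⟨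
        P k+1 (suc j) + d               ≤⟨ +-monoˡ-≤ d (P-mono k+1 j<F) ⟩
        P k+1 (ℓ N a) + d               ≤⟨ +-monoˡ-≤ d (P-bound k) ⟩
        K ^ suc N * ℓ k a + d           ≤⟨ +-monoˡ-≤ d (*-monoʳ-≤ (K ^ suc N) ℓk≤Kd) ⟩
        K ^ suc N * (K * d) + d         ≡⟨ cong (_+ d) (*-assoc (K ^ suc N) K d) ⟨
        K ^ suc N * K * d + d           ≡⟨ cong (λ k → k * d + d) (*-comm (K ^ suc N) K) ⟩
        K ^ suc (suc N) * d + d         ≡⟨ +-comm _ d ⟩
        recurrenceConstant * d          ≡⟨ *-comm recurrenceConstant d ⟩
        d * recurrenceConstant          ≤⟨ dM≤L ⟩
        L                               ∎
        where open ≤-Reasoning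

-- Automatic fixed points have almost proportional lengths

module _ {q : ℕ} .{{_ : NonZero q}} where

  %-cong-+ : ∀ {a b} c → a % q ≡ b % q → (a + c) % q ≡ (b + c) % q
  %-cong-+ {a} {b} c eq = trans (%-distribˡ-+ a c q)
    (trans (cong (λ r → (r + c % q) % q) eq) (sym (%-distribˡ-+ b c q)))

  %-≡⇒∣ : ∀ a d → (a + d) % q ≡ a % q → q ∣ d
  %-≡⇒∣ a d eq = ∣m+n∣m⇒∣n {m = a / q * q} (divides ((a + d) / q) (+-cancelˡ-≡ (a % q) _ _ (begin
    a % q + (a / q * q + d)              ≡⟨ +-assoc (a % q) _ d ⟨
    a % q + a / q * q + d                ≡⟨ cong (_+ d) (m≡m%n+[m/n]*n a q) ⟨
    a + d                                ≡⟨ m≡m%n+[m/n]*n (a + d) q ⟩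
    (a + d) % q + (a + d) / q * q        ≡⟨ cong (_+ (a + d) / q * q) eq ⟩
    a % q + (a + d) / q * q              ∎))) (divides-refl (a / q))
    where open ≡-Reasoning

  -- Following the translation by D inside the finite set of residues of f, one returns to a residue.
  translation-order : ∀ {t} (f : Fin (suc t) → ℕ) (D : ℕ) →
    (∀ i → ∃[ j ] f j % q ≡ (f i + D) % q) → ∃[ c ] c < suc t × q ∣ suc c * D
  translation-order {t} f D next = returns (Fin.pigeonhole ≤-refl (walk ∘ toℕ))
    where
    walk : ℕ → Fin (suc t)
    walk zero    = zero
    walk (suc i) = proj₁ (next (walk i))

    steps : ∀ i k → f (walk (k + i)) % q ≡ (f (walk i) + k * D) % q
    steps i zero    = cong (_% q) (sym (+-identityʳ (f (walk i))))
    steps i (suc k) = begin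
      f (walk (suc k + i)) % q             ≡⟨ proj₂ (next (walk (k + i))) ⟩
      (f (walk (k + i)) + D) % q           ≡⟨ %-cong-+ D (steps i k) ⟩
      (f (walk i) + k * D + D) % q         ≡⟨ cong (_% q) (+-assoc (f (walk i)) (k * D) D) ⟩
      (f (walk i) + (k * D + D)) % q       ≡⟨ cong (λ r → (f (walk i) + r) % q) (+-comm (k * D) D) ⟩
      (f (walk i) + suc k * D) % q         ∎
      where open ≡-Reasoning

    returns : ∃[ i ] ∃[ j ] toℕ {suc (suc t)} i < toℕ j × walk (toℕ i) ≡ walk (toℕ j) →
              ∃[ c ] c < suc t × q ∣ suc c * D
    returns (i , j , i<j , eq) = c , c<1+t , %-≡⇒∣ (f (walk (toℕ i))) (suc c * D) (begin
      (f (walk (toℕ i)) + suc c * D) % q   ≡⟨ steps (toℕ i) (suc c) ⟨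
      f (walk (suc c + toℕ i)) % q         ≡⟨ cong (λ k → f (walk k) % q) c+1+i≡j ⟩
      f (walk (toℕ j)) % q                 ≡⟨ cong (λ k → f k % q) eq ⟨
      f (walk (toℕ i)) % q                 ∎)
      where
      open ≡-Reasoning
      c = toℕ j ∸ suc (toℕ i)
      c+1+i≡j : suc c + toℕ i ≡ toℕ j
      c+1+i≡j = trans (sym (+-suc c (toℕ i))) (m∸n+n≡m i<j)
      c<1+t : c < suc t
      c<1+t = s≤s⁻¹ (<-≤-trans (s≤s (subst (c <_) c+1+i≡j (s≤s (m≤m+n c (toℕ i))))) (Fin.toℕ<n j))

-- Occurrences of a prefix inside pairs of blocks of length q

module _ {B : Set} {r q : ℕ} .{{_ : NonZero q}} (y : Seq B) (z : Seq (Fin r))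
         (blocks : ∀ {i j} → z i ≡ z j → ∀ {e} → e < q → y (i * q + e) ≡ y (j * q + e)) where

  two-blocks : ∀ {i j} → z i ≡ z j → z (suc i) ≡ z (suc j) → ∀ {e} → e < q + q →
               y (i * q + e) ≡ y (j * q + e)
  two-blocks {i} {j} zi≡zj zi′≡zj′ {e} e<2q with e <? q
  ... | yes e<q = blocks zi≡zj e<q
  ... | no  e≮q = trans (cong y (shift i)) (trans (blocks zi′≡zj′ d<q) (cong y (sym (shift j))))
    where
    d = e ∸ q
    q+d≡e = m+[n∸m]≡n (≮⇒≥ e≮q)
    d<q : d < q
    d<q = +-cancelˡ-< q d q (subst (_< q + q) (sym q+d≡e) e<2q)
    shift : ∀ i → i * q + e ≡ suc i * q + d
    shift i = trans (cong (i * q +_) (sym q+d≡e))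
      (trans (sym (+-assoc (i * q) q d)) (cong (_+ d) (+-comm (i * q) q)))

  module _ {M : ℕ} (nonperiodic : ∀ d → 1 ≤ d → d * M ≤ q → ¬ (∀ s → s + d < q → y (s + d) ≡ y s)) where

    -- Divides the offsets 0, ..., q - 1 into M intervals. Two offsets in the same interval differ
    -- by some d with d M ≤ q, which is the range of periods excluded by `nonperiodic`.
    bucket : ℕ → ℕ
    bucket u = u % q * M / q

    bucket<M : 1 ≤ M → ∀ u → bucket u < M
    bucket<M 1≤M u = m<n*o⇒m/o<n (subst (u % q * M <_) (*-comm q M)
      (*-monoˡ-< M {{1≤⇒NonZero 1≤M}} (m%n<n u q)))

    Occurrence : ℕ → Set
    Occurrence u = ∀ {e} → e < q → y (u + e) ≡ y e

    -- The prefix of length q read at two close offsets t < t′ of the same pair of blocks has the period t′ ∸ t.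
    same-key⇒≮ : ∀ u v → Occurrence u → Occurrence v → bucket u ≡ bucket v →
      z (u / q) ≡ z (v / q) → z (suc (u / q)) ≡ z (suc (v / q)) → ¬ (u % q < v % q)
    same-key⇒≮ u v occ-u occ-v same z≡ z≡′ t<t′ = nonperiodic d 1≤d dM≤q periodic
      where
      t = u % q
      t′ = v % q
      d = t′ ∸ t
      t+d≡t′ : t + d ≡ t′
      t+d≡t′ = m+[n∸m]≡n (<⇒≤ t<t′)
      1≤d : 1 ≤ d
      1≤d = m<n⇒0<n∸m t<t′
      dM≤q : d * M ≤ q
      dM≤q = +-cancelˡ-≤ (bucket u * q) _ _ (begin
        bucket u * q + d * M               ≤⟨ +-monoˡ-≤ (d * M) (m/n*n≤m (t * M) q) ⟩
        t * M + d * M                      ≡⟨ *-distribʳ-+ M t d ⟨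
        (t + d) * M                        ≡⟨ cong (_* M) t+d≡t′ ⟩
        t′ * M                             ≡⟨ m≡m%n+[m/n]*n (t′ * M) q ⟩
        t′ * M % q + bucket v * q          ≡⟨ cong (λ b → t′ * M % q + b * q) same ⟨
        t′ * M % q + bucket u * q          ≤⟨ +-monoˡ-≤ (bucket u * q) (m%n≤n (t′ * M) q) ⟩
        q + bucket u * q                   ≡⟨ +-comm q _ ⟩
        bucket u * q + q                   ∎)
        where open ≤-Reasoning
      split : ∀ w e → w + e ≡ w / q * q + (w % q + e)
      split w e = trans (cong (_+ e) (trans (m≡m%n+[m/n]*n w q) (+-comm (w % q) _))) (+-assoc (w / q * q) _ e)
      -- Offset t′ + s of the common pair of blocks is read twice: from the occurrence at `u` it is
      -- letter s + d of the prefix, from the occurrence at `v` it is letter s.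
      periodic : ∀ s → s + d < q → y (s + d) ≡ y s
      periodic s s+d<q = begin
        y (s + d)                          ≡⟨ occ-u s+d<q ⟨
        y (u + (s + d))                    ≡⟨ cong y (split u (s + d)) ⟩
        y (u / q * q + (t + (s + d)))      ≡⟨ cong (λ k → y (u / q * q + k)) (begin
            t + (s + d)    ≡⟨ cong (t +_) (+-comm s d) ⟩
            t + (d + s)    ≡⟨ +-assoc t d s ⟨
            t + d + s      ≡⟨ cong (_+ s) t+d≡t′ ⟩
            t′ + s         ∎) ⟩
        y (u / q * q + (t′ + s))           ≡⟨ two-blocks z≡ z≡′ (+-mono-< (m%n<n v q) s<q) ⟩
        y (v / q * q + (t′ + s))           ≡⟨ cong y (split v s) ⟨
        y (v + s)                          ≡⟨ occ-v s<q ⟩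
        y s                                ∎
        where
        open ≡-Reasoning
        s<q = ≤-<-trans (m≤m+n s d) s+d<q

    -- Pigeonhole on the bucket of the offset and the two letters of z whose blocks the occurrence
    -- meets: there are M r² such keys, and two occurrences with the same key must have equal
    -- offsets.
    congruent-occurrences : 1 ≤ M → (f : Fin (suc (M * (r * r))) → ℕ) → (∀ i → Occurrence (f i)) →
      ∃[ i ] ∃[ j ] i ≢ j × f i % q ≡ f j % q
    congruent-occurrences 1≤M f occ with Fin.pigeonhole ≤-refl key
      where
      key : Fin (suc (M * (r * r))) → Fin (M * (r * r))
      key i = combine (fromℕ< (bucket<M 1≤M (f i))) (combine (z (f i / q)) (z (suc (f i / q))))
    ... | i , j , i<j , eq with Fin.combine-injective (fromℕ< (bucket<M 1≤M (f i))) _ _ _ eq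
    ... | bucket≡ , eq′ with Fin.combine-injective (z (f i / q)) _ _ _ eq′
    ... | z≡ , z≡′ = i , j , (λ i≡j → <⇒≢ i<j (cong toℕ i≡j)) , %≡
      where
      same : bucket (f i) ≡ bucket (f j)
      same = trans (sym (Fin.toℕ-fromℕ< _)) (trans (cong toℕ bucket≡) (Fin.toℕ-fromℕ< _))
      %≡ : f i % q ≡ f j % q
      %≡ with <-cmp (f i % q) (f j % q)
      ... | tri≈ _ e _ = e
      ... | tri< l _ _ = contradiction l (same-key⇒≮ (f i) (f j) (occ i) (occ j) same z≡ z≡′)
      ... | tri> _ _ g = contradiction g (same-key⇒≮ (f j) (f i) (occ j) (occ i) (sym same) (sym z≡) (sym z≡′))

∣suc*⇒∣!* : ∀ {q C c D} → c < C → q ∣ suc c * D → q ∣ C ! * D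
∣suc*⇒∣!* {q} {C} {c} {D} c<C q∣ = ∣-trans q∣ (*-pres-∣ {suc c} (∣-trans (m∣m*n {suc c} (c !)) (m≤n⇒m!∣n! c<C)) (∣-refl {D}))

-- The sets enumerated by P n decrease with n along steps of N.
module TorsionLevels (P : ℕ → ℕ → ℕ) (N F : ℕ) (P-zero : ∀ n → P n 0 ≡ 0)
  (shift : ∀ n i {e} → e ≤ F → ∃[ i′ ] P n i′ ≡ P (n + N) i + P n e)
  (q C : ℕ) .{{_ : NonZero q}} where

  descend : ∀ n i → ∃[ i′ ] P n i′ ≡ P (n + N) i
  descend n i with shift n i z≤n
  ... | i′ , eq = i′ , trans eq (trans (cong (P (n + N) i +_) (P-zero n)) (+-identityʳ _))

  -- The additive order of `P n e` modulo q is at most `C`.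
  Torsion : ℕ → ℕ → Set
  Torsion n e = ∃[ c ] c < C × q ∣ suc c * P n e

  torsion? : ∀ n e → Dec (Torsion n e)
  torsion? n e = anyUpTo? (λ c → q ∣? suc c * P n e) C

  TorsionLevel : ℕ → Set
  TorsionLevel n = ∀ {e} → e < suc F → Torsion n e

  Incongruent : ∀ {t} → (Fin t → ℕ) → Set
  Incongruent f = ∀ i j → f i % q ≡ f j % q → i ≡ j

  Found : ℕ → ℕ → Set
  Found t n = ∃[ n′ ] n ≤ n′ × n′ ≤ n + t * N × TorsionLevel n′

  level? : ∀ n → TorsionLevel n ⊎ ∃[ e ] e ≤ F × ¬ Torsion n e
  level? n with anyUpTo? (¬? ∘ torsion? n) (suc F)
  ... | yes (e , e<1+F , ¬t) = inj₂ (e , s≤s⁻¹ e<1+F , ¬t)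
  ... | no all-torsion       = inj₁ (λ {e} e<F → decidable-stable (torsion? n e) (λ ¬t → all-torsion (e , e<F , ¬t)))

  Family : ℕ → ℕ → Set
  Family n t = Σ[ f ∈ (Fin t → ℕ) ] (∀ i → ∃[ p ] f i ≡ P n p) × Incongruent f

  -- If translation by `P n e` mapped the residues of the family into themselves,
  -- `translation-order` would bound the order of `P n e`. So some translate is a new residue; by
  -- `shift` it is a value of `P n`, as are the old members by `descend`.
  adjoin : ∀ {t} → suc t ≤ C → ∀ n → Family (n + N) (suc t) →
           ∀ {e} → e ≤ F → ¬ Torsion n e → Family n (suc (suc t))
  adjoin {t} t<C n (f , pos , incongruent) {e} e≤F ¬torsion = add fresh
    where
    fresh : ∃[ i ] ∀ j → f j % q ≢ (f i + P n e) % q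
    fresh = decidable-stable (Fin.any? (λ i → Fin.all? (λ j → ¬? (f j % q ≟ (f i + P n e) % q))))
      λ closed → ¬torsion (Product.map₂ (Product.map₁ (λ c≤t → <-≤-trans c≤t t<C))
        (translation-order f (P n e) (λ i → decidable-stable
          (Fin.any? (λ j → f j % q ≟ (f i + P n e) % q))
          (λ ¬∃ → closed (i , λ j eq → ¬∃ (j , eq))))))

    add : ∃[ i ] (∀ j → f j % q ≢ (f i + P n e) % q) → Family n (suc (suc t))
    add (i₀ , new) = g , pos-g , incongruent-g
      where
      g : Fin (suc (suc t)) → ℕ
      g zero    = f i₀ + P n e
      g (suc i) = f i
      pos-g : ∀ i → ∃[ p ] g i ≡ P n p
      pos-g zero with pos i₀
      ... | p , eq with shift n p e≤F
      ... | p′ , eq′ = p′ , trans (cong (_+ P n e) eq) (sym eq′)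
      pos-g (suc i) with pos i
      ... | p , eq with descend n p
      ... | p′ , eq′ = p′ , trans eq (sym eq′)
      incongruent-g : Incongruent g
      incongruent-g zero    zero    _  = refl
      incongruent-g zero    (suc j) eq = contradiction (sym eq) (new j)
      incongruent-g (suc i) zero    eq = contradiction eq (new i)
      incongruent-g (suc i) (suc j) eq = cong suc (incongruent i j eq)

  -- As long as no torsion level is met, each descent by N levels adds a new residue mod q.
  torsion-or-incongruent : ∀ t → t ≤ C → ∀ n → Found t n ⊎ Family n (suc t)
  torsion-or-incongruent zero _ n = inj₂ ((λ _ → 0) , (λ _ → 0 , sym (P-zero n)) , λ { zero zero _ → refl })
  torsion-or-incongruent (suc t) t<C n =
    [ inj₁ ∘ raise , (λ family → Sum.map here′ (λ (e , e≤F , ¬t) → adjoin t<C n family e≤F ¬t) (level? n)) ]′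
      (torsion-or-incongruent t (<⇒≤ t<C) (n + N))
    where
    raise : Found t (n + N) → Found (suc t) n
    raise (n′ , n≤n′ , n′≤ , level) = n′ , ≤-trans (m≤m+n n _) n≤n′ ,
      subst (n′ ≤_) (+-assoc n N (t * N)) n′≤ , level
    here′ : TorsionLevel n → Found (suc t) n
    here′ level = n , ≤-refl , m≤m+n n _ , level

  -- Without a torsion level the descent would collect C + 1 pairwise incongruent values of `P n`,
  -- against `collision`.
  torsion-level : ∀ n →
    ((f : Fin (suc C) → ℕ) → (∀ i → ∃[ p ] f i ≡ P n p) → ∃[ i ] ∃[ j ] i ≢ j × f i % q ≡ f j % q) →
    Found C n
  torsion-level n collision = [ id , (λ (f , pos , incongruent) → contradicts incongruent (collision f pos)) ]′
    (torsion-or-incongruent C ≤-refl n)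
    where
    contradicts : {f : Fin (suc C) → ℕ} → Incongruent f → ∃[ i ] ∃[ j ] i ≢ j × f i % q ≡ f j % q → Found C n
    contradicts incongruent (i , j , i≢j , eq) = contradiction (incongruent i j eq) i≢j

module Divisibility {φ : Substitution m} (pp : ProperPrimitive φ)
                    (x : Seq (Fin m)) (fixed : ∀ n → concatMap φ (prefix x n) ≼ x) where
  open Recurrence pp x fixed

  -- Every block of level N + 1 begins with φᴺ(a), hence with the first |φᴺ(a)| letters of x. The
  -- one level lost to left-properness is the reason for steps of N + 1 instead of N.
  P-shift-full : ∀ n i {e} → e ≤ ℓ N a → P n (P (suc N) i + e) ≡ P (n + suc N) i + P n e
  P-shift-full n i {e} e≤F = trans
    (P-shift n (P (suc N) i) e (λ e′<e → block-start proper N i (<-≤-trans e′<e e≤F)))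
    (cong (_+ P n e) (sym (P-+ n (suc N) i)))

  -- At a torsion level, C! is a multiple of the order of each `P n e` with e ≤ |φᴺ(a)|. If b stands
  -- at position e, then ℓₙ(b) is the difference of two consecutive such values, and every letter
  -- stands at some position below |φᴺ(a)|.
  common-divisor : ∀ {q C n₀} .{{_ : NonZero q}} →
    ((f : Fin (suc C) → ℕ) → (∀ i → ∃[ p ] f i ≡ P (suc n₀) p) → ∃[ i ] ∃[ j ] i ≢ j × f i % q ≡ f j % q) →
    ∃[ n ] n₀ < n × n ≤ suc n₀ + C * suc N × (∀ b → q ∣ C ! * ℓ n b)
  common-divisor {q} {C} {n₀} collision = from-level (torsion-level (suc n₀) collision)
    where
    open TorsionLevels P (suc N) (ℓ N a) P-zero (λ n i e≤F → _ , P-shift-full n i e≤F) q C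
    from-level : Found C (suc n₀) → ∃[ n ] n₀ < n × n ≤ suc n₀ + C * suc N × (∀ b → q ∣ C ! * ℓ n b)
    from-level (n , n₀<n , n≤ , level) = n , n₀<n , n≤ , divides-ℓ
      where
      divides-P : ∀ {e} → e ≤ ℓ N a → q ∣ C ! * P n e
      divides-P e≤F with level (s≤s e≤F)
      ... | c , c<C , q∣ = ∣suc*⇒∣!* c<C q∣
      divides-ℓ : ∀ b → q ∣ C ! * ℓ n b
      divides-ℓ b with find-letter b
      ... | e , e<F , refl = ∣m+n∣m⇒∣n (subst (q ∣_) (trans (cong (C ! *_) (P-suc n e))
              (*-distribˡ-+ (C !) (P n e) _)) (divides-P e<F)) (divides-P (<⇒≤ e<F))

-- Uniform lengths, ratios of sums and the Perron-Frobenius argument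

module _ {k : ℕ} {ψ : Substitution m} (uniform : HasConstantLength k ψ) where

  length-concatMap-uniform : ∀ w → length (concatMap ψ w) ≡ k * length w
  length-concatMap-uniform []      = sym (*-zeroʳ k)
  length-concatMap-uniform (b ∷ w) = trans (length-++ (ψ b))
    (trans (cong₂ _+_ (uniform b) (length-concatMap-uniform w)) (sym (*-suc k (length w))))

  length-iterate-uniform : ∀ n w → length (iterateSubst ψ n w) ≡ k ^ n * length w
  length-iterate-uniform zero    w = sym (*-identityˡ _)
  length-iterate-uniform (suc n) w = trans (length-concatMap-uniform (iterateSubst ψ n w))
    (trans (cong (k *_) (length-iterate-uniform n w)) (sym (*-assoc k (k ^ n) _)))

∃-minimal-ratio : (f g : Fin (suc m) → ℕ) → (∀ b → 1 ≤ g b) → ∃[ i ] ∀ c → f i * g c ≤ f c * g i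
∃-minimal-ratio {zero}  f g 1≤g = zero , λ { zero → ≤-refl }
∃-minimal-ratio {suc m} f g 1≤g with ∃-minimal-ratio (f ∘ suc) (g ∘ suc) (1≤g ∘ suc)
... | i , minimal with ≤-total (f (suc i) * g zero) (f zero * g (suc i))
... | inj₁ ≤zero = suc i , λ { zero → ≤zero ; (suc c) → minimal c }
... | inj₂ zero≤ = zero , λ { zero → ≤-refl ; (suc c) → *-cancelʳ-≤ _ _ (g (suc i)) {{1≤⇒NonZero (1≤g (suc i))}} (begin
    f zero * g (suc c) * g (suc i)     ≡⟨ xy∙z≈xz∙y (f zero) _ _ ⟩
    f zero * g (suc i) * g (suc c)     ≤⟨ *-monoˡ-≤ (g (suc c)) zero≤ ⟩
    f (suc i) * g zero * g (suc c)     ≡⟨ xy∙z≈xz∙y (f (suc i)) _ _ ⟩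
    f (suc i) * g (suc c) * g zero     ≤⟨ *-monoˡ-≤ (g zero) (minimal c) ⟩
    f (suc c) * g (suc i) * g zero     ≡⟨ xy∙z≈xz∙y (f (suc c)) _ _ ⟩
    f (suc c) * g zero * g (suc i)     ∎) }
  where
  open ≤-Reasoning

sum-map-scale : {A : Set} {f g : A → ℕ} (α β : ℕ) → (∀ c → α * f c ≡ β * g c) →
  ∀ w → α * sum (map f w) ≡ β * sum (map g w)
sum-map-scale α β eq []      = trans (*-zeroʳ α) (sym (*-zeroʳ β))
sum-map-scale {f = f} {g} α β eq (c ∷ w) = trans (*-distribˡ-+ α (f c) _)
  (trans (cong₂ _+_ (eq c) (sum-map-scale α β eq w)) (sym (*-distribˡ-+ β (g c) _)))

sum-map-≤ : {A : Set} {f g : A → ℕ} (α β : ℕ) → (∀ c → α * f c ≤ β * g c) →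
  ∀ w → α * sum (map f w) ≤ β * sum (map g w)
sum-map-≤ α β le []      = ≤-reflexive (trans (*-zeroʳ α) (sym (*-zeroʳ β)))
sum-map-≤ {f = f} {g} α β le (c ∷ w) = subst₂ _≤_ (sym (*-distribˡ-+ α (f c) _)) (sym (*-distribˡ-+ β (g c) _))
  (+-mono-≤ (le c) (sum-map-≤ α β le w))

-- The rigidity behind the Perron-Frobenius step: no term can be strict, since the remaining terms
-- could not make up for it.
sum-map-≡⇒≡ : {A : Set} {f g : A → ℕ} (α β : ℕ) → (∀ c → α * f c ≤ β * g c) →
  ∀ w → β * sum (map g w) ≡ α * sum (map f w) → ∀ {c} → c ∈ w → β * g c ≡ α * f c
sum-map-≡⇒≡ {f = f} {g} α β le (d ∷ w) eq = λ
  { (here refl) → ≤-antisym (+-cancelʳ-≤ (α * sum (map f w)) _ _ (≤-trans (+-monoʳ-≤ (β * g d) rest≤) (≤-reflexive eq′))) (le d)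
  ; (there c∈w) → sum-map-≡⇒≡ α β le w (≤-antisym (+-cancelˡ-≤ (α * f d) _ _
      (≤-trans (+-monoˡ-≤ (β * sum (map g w)) (le d)) (≤-reflexive eq′))) rest≤) c∈w }
  where
  rest≤ = sum-map-≤ {f = f} {g} α β le w
  eq′ : β * g d + β * sum (map g w) ≡ α * f d + α * sum (map f w)
  eq′ = trans (sym (*-distribˡ-+ β (g d) _)) (trans eq (*-distribˡ-+ α (f d) _))

repeated-function : ∀ {B} (ρ : ℕ → Fin m → Fin B) → ∃[ h ] ∃[ h′ ] h < h′ × (∀ b → ρ h b ≡ ρ h′ b)
repeated-function {m} {B} ρ with Fin.pigeonhole {B ^ m} ≤-refl (λ h → funToFin (ρ (toℕ h)))
... | h , h′ , h<h′ , eq = toℕ h , toℕ h′ , h<h′ , λ b →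
  trans (sym (Fin.finToFun-funToFin (ρ (toℕ h)) b))
    (trans (cong (λ c → finToFun c b) eq) (Fin.finToFun-funToFin (ρ (toℕ h′)) b))

module Perron {m} {φ : Substitution (suc m)} (pp : ProperPrimitive φ) where
  open Growth pp

  -- If ℓₙ is an eigenvector of a positive power of M, then so is ℓₙ₊₁ = ℓₙ M, for the same eigenvalue;
  -- the letter minimising the ratio of the two shows that they are proportional.
  consecutive-proportional : ∀ n {D} → N ≤ D → Proportional (ℓ (n + D)) (ℓ n) → Proportional (ℓ (suc n)) (ℓ n)
  consecutive-proportional n {D} N≤D (α , β , 1≤α , eq)
    with ∃-minimal-ratio (ℓ (suc n)) (ℓ n) (ℓ-positive nonerasing n)
  ... | i , minimal = g , p , ℓ-positive nonerasing n i , λ c →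
        sum-map-≡⇒≡ {f = ℓ n} {ℓ (suc n)} p g p≤g (iterateSubst φ D [ i ]) sums (full-beyond N≤D c i)
    where
    g = ℓ n i
    p = ℓ (suc n) i
    p≤g : ∀ c → p * ℓ n c ≤ g * ℓ (suc n) c
    p≤g c = subst (p * ℓ n c ≤_) (*-comm (ℓ (suc n) c) g) (minimal c)
    eq-suc : ∀ c → α * ℓ (suc (n + D)) c ≡ β * ℓ (suc n) c
    eq-suc c = subst₂ (λ u v → α * u ≡ β * v) (sym (ℓ-suc (n + D) c)) (sym (ℓ-suc n c))
      (sum-map-scale α β eq (φ c))
    -- The factor β / α relates both lengths of `i` to those D levels higher, so it cancels and the
    -- minimal ratio p / g reappears there.
    ends : g * ℓ (suc n + D) i ≡ p * ℓ (n + D) i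
    ends = *-cancelˡ-≡ _ _ α {{1≤⇒NonZero 1≤α}} (begin
      α * (g * ℓ (suc n + D) i)   ≡⟨ x∙yz≈y∙xz α g _ ⟩
      g * (α * ℓ (suc n + D) i)   ≡⟨ cong (g *_) (eq-suc i) ⟩
      g * (β * p)                 ≡⟨ x∙yz≈z∙yx g β p ⟩
      p * (β * g)                 ≡⟨ cong (p *_) (eq i) ⟨
      p * (α * ℓ (n + D) i)       ≡⟨ x∙yz≈y∙xz p α _ ⟩
      α * (p * ℓ (n + D) i)       ∎)
      where
      open ≡-Reasoning
    -- Expanded along φᴰ(i), the two totals have the minimal ratio. Every letter occurs in that
    -- word, so every letter must attain the minimum.
    sums : g * sum (map (ℓ (suc n)) (iterateSubst φ D [ i ])) ≡ p * sum (map (ℓ n) (iterateSubst φ D [ i ]))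
    sums = subst₂ (λ u v → g * u ≡ p * v) (ℓ-+ (suc n) D i) (ℓ-+ n D i) ends

-- Levels of an automatic fixed point with bounded quotients

module AutomaticLengths {φ : Substitution m} (pp : ProperPrimitive φ) (distinct : Distinct m)
                        (x : Seq (Fin m)) (fixed : ∀ n → concatMap φ (prefix x n) ≼ x)
                        {n : ℕ} (τ : Fin m → Fin n) (nonperiodic : ¬ Periodic (τ ∘ x)) where
  open Recurrence pp x fixed
  open Divisibility pp x fixed

  private
    K = proj₁ (Fin-bounded (length ∘ φ))
    bound = proj₂ (Fin-bounded (length ∘ φ))
    M = recurrenceConstant bound distinct

  module _ {k r : ℕ} (2≤k : 2 ≤ k) {ψ : Substitution r} (uniform : HasConstantLength k ψ)
           (π : Fin r → Fin n) (z : Seq (Fin r)) (z-fixed : ∀ n → concatMap ψ (prefix z n) ≼ z)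
           (coded : ∀ i → τ (x i) ≡ π (z i)) where

    -- The number of keys in the pigeonhole: M buckets times r² pairs of letters.
    C : ℕ
    C = M * (r * r)

    blocks : ∀ j {i i′} → z i ≡ z i′ → ∀ {e} → e < k ^ j → τ (x (i * k ^ j + e)) ≡ τ (x (i′ * k ^ j + e))
    blocks j {i} {i′} eq {e} e<q = trans (coded _) (trans (cong π (subst₂ (λ u v → z (u + e) ≡ z (v + e))
        (position i) (position i′)
        (same-block j eq (subst (e <_) (sym (trans (length-iterate-uniform uniform j [ z i ]) (*-identityʳ _))) e<q))))
      (sym (coded _)))
      where
      open FixedPoint ψ z z-fixed using (same-block) renaming (P to Pᶻ)
      position : ∀ i → Pᶻ j i ≡ i * k ^ j
      position i = trans (length-iterate-uniform uniform j (prefix z i))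
        (trans (cong (k ^ j *_) (length-applyUpTo z i)) (*-comm (k ^ j) i))

    no-short-period : ∀ q d → 1 ≤ d → d * M ≤ q → ¬ (∀ s → s + d < q → τ (x (s + d)) ≡ τ (x s))
    no-short-period q d 1≤d dM≤q periodic =
      nonperiodic (d , 1≤d , period-of-prefix bound distinct τ 1≤d dM≤q periodic)

    k≢0 : NonZero k
    k≢0 = 1≤⇒NonZero (<⇒≤ 2≤k)

    -- Every cutting point of level n₀ + 1 is an occurrence of the prefix of length |φⁿ(a)| for n =
    -- n₀, hence of its prefix of length kʲ.
    collision : ∀ j {n₀} → k ^ j ≤ ℓ n₀ a → (f : Fin (suc C) → ℕ) → (∀ i → ∃[ p ] f i ≡ P (suc n₀) p) →
      ∃[ i ] ∃[ i′ ] i ≢ i′ × (f i % (k ^ j)) {{m^n≢0 k j {{k≢0}}}} ≡ (f i′ % (k ^ j)) {{m^n≢0 k j {{k≢0}}}}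
    collision j {n₀} q≤ℓ f positions = congruent-occurrences {{m^n≢0 k j {{k≢0}}}} (τ ∘ x) z (blocks j)
      (no-short-period (k ^ j)) (s≤s z≤n) f
      λ i {e} e<q → trans (cong (λ u → τ (x (u + e))) (proj₂ (positions i)))
        (cong τ (block-start proper n₀ (proj₁ (positions i)) (<-≤-trans e<q q≤ℓ)))

    -- The first summand bounds how far the descent may end above n₀. The additional N allows
    -- lengths of all letters to be compared with that of `a`, and keeps the levels obtained from
    -- two samples at least N apart.
    gap : ℕ
    gap = suc (C * suc N) + N

    ratioBound : ℕ
    ratioBound = C ! * (K ^ gap * k)

    -- The quotients are kept in a finite type so that they can be compared by pigeonhole, although
    -- `divisor` is unbounded in n₀.
    record Level (n₀ : ℕ) : Set where
      constructor mkLevel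
      field
        {index divisor}   : ℕ
        n₀<index          : n₀ < index
        index≤            : index ≤ n₀ + suc (C * suc N)
        1≤divisor         : 1 ≤ divisor
        ratios            : Fin m → Fin (suc ratioBound)
        ℓ-ratios          : ∀ b → C ! * ℓ index b ≡ toℕ (ratios b) * divisor
    open Level

    level : ∀ n₀ → Level n₀
    -- The power kʲ is the largest one not exceeding ℓ(a) at level n₀. That it fits yields the
    -- collision; that the next power does not fit bounds the quotients.
    level n₀ with crossing (k ^_) (ℓ n₀ a) (ℓ-positive nonerasing n₀ a) (n<k^n 2≤k (ℓ n₀ a))
    ... | j , q≤ℓ , ℓ<kq with common-divisor {{m^n≢0 k j {{k≢0}}}} (collision j {n₀} q≤ℓ)
    ... | n , n₀<n , n≤ , q∣ = mkLevel n₀<n n≤′ (m^n>0 k {{k≢0}} j)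
          (λ b → fromℕ< (s≤s (small b)))
          λ b → trans (_∣_.equality (q∣ b)) (cong (_* k ^ j) (sym (Fin.toℕ-fromℕ< (s≤s (small b)))))
      where
      n≤′ : n ≤ n₀ + suc (C * suc N)
      n≤′ = subst (n ≤_) (sym (+-suc n₀ _)) n≤
      small : ∀ b → quotient (q∣ b) ≤ ratioBound
      small b = *-cancelʳ-≤ _ _ (k ^ j) {{m^n≢0 k j {{k≢0}}}} (begin
        quotient (q∣ b) * k ^ j            ≡⟨ _∣_.equality (q∣ b) ⟨
        C ! * ℓ n b                        ≤⟨ *-monoʳ-≤ (C !) (begin
            ℓ n b                            ≤⟨ ℓ-≤-shift n b a ⟩
            ℓ (n + N) a                      ≤⟨ ℓ-mono nonerasing a (≤-trans (+-monoˡ-≤ N n≤′)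
                                                  (≤-reflexive (trans (+-assoc n₀ _ N) (+-comm n₀ gap)))) ⟩
            ℓ (gap + n₀) a                   ≤⟨ ℓ-+-≤ bound gap n₀ a ⟩
            K ^ gap * ℓ n₀ a                 ≤⟨ *-monoʳ-≤ (K ^ gap) (<⇒≤ ℓ<kq) ⟩
            K ^ gap * (k * k ^ j)            ≡⟨ *-assoc (K ^ gap) k _ ⟨
            K ^ gap * k * k ^ j              ∎) ⟩
        C ! * (K ^ gap * k * k ^ j)        ≡⟨ *-assoc (C !) _ _ ⟨
        ratioBound * k ^ j                          ∎)
        where open ≤-Reasoning

    DistantProportional : Set
    DistantProportional = ∃[ n ] ∃[ D ] N ≤ D × Proportional (ℓ (n + D)) (ℓ n)

    -- With equal quotients ρ, both C! ℓₙ = ρ q and C! ℓₙ′ = ρ q′ hold, so the two length vectors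
    -- have the ratio q′ / q.
    same-ratios : ∀ {n₀ n₀′} (L : Level n₀) (L′ : Level n₀′) → n₀ + gap ≤ n₀′ →
                  (∀ b → ratios L b ≡ ratios L′ b) → DistantProportional
    same-ratios {n₀} {n₀′} (mkLevel {n} {q} _ n≤ 1≤q ρ eq) (mkLevel {n′} {q′} <n′ _ _ ρ′ eq′) n₀+gap≤ ρ≡ =
      n , n′ ∸ n , N≤D , q , q′ , 1≤q , λ b →
        subst (λ k → q * ℓ k b ≡ q′ * ℓ n b) (sym (m+[n∸m]≡n (m+n≤o⇒m≤o n n+N≤n′))) (proportional b)
      where
      n+N≤n′ : n + N ≤ n′
      n+N≤n′ = begin
        n + N                                 ≤⟨ +-monoˡ-≤ N n≤ ⟩
        n₀ + suc (C * suc N) + N              ≡⟨ +-assoc n₀ _ N ⟩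
        n₀ + gap                              ≤⟨ n₀+gap≤ ⟩
        n₀′                                   ≤⟨ <⇒≤ <n′ ⟩
        n′                                    ∎
        where open ≤-Reasoning
      N≤D : N ≤ n′ ∸ n
      N≤D = m+n≤o⇒m≤o∸n N (subst (_≤ n′) (+-comm n N) n+N≤n′)
      proportional : ∀ b → q * ℓ n′ b ≡ q′ * ℓ n b
      proportional b = *-cancelˡ-≡ _ _ (C !) {{C !≢0}} (begin
        C ! * (q * ℓ n′ b)           ≡⟨ x∙yz≈y∙xz (C !) q _ ⟩
        q * (C ! * ℓ n′ b)           ≡⟨ cong (q *_) (eq′ b) ⟩
        q * (toℕ (ρ′ b) * q′)        ≡⟨ cong (λ u → q * (toℕ u * q′)) (ρ≡ b) ⟨
        q * (toℕ (ρ b) * q′)         ≡⟨ x∙yz≈z∙yx q (toℕ (ρ b)) q′ ⟩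
        q′ * (toℕ (ρ b) * q)         ≡⟨ cong (q′ *_) (eq b) ⟨
        q′ * (C ! * ℓ n b)           ≡⟨ x∙yz≈y∙xz q′ (C !) _ ⟩
        C ! * (q′ * ℓ n b)           ∎)
        where
        open ≡-Reasoning

    -- There are only finitely many quotient functions, so two of the levels sampled at multiples of
    -- `gap` share the same one.
    distant-proportional : DistantProportional
    distant-proportional = repeated (repeated-function (λ h → ratios (level (h * gap))))
      where
      repeated : ∃[ h ] ∃[ h′ ] h < h′ × (∀ b → ratios (level (h * gap)) b ≡ ratios (level (h′ * gap)) b) →
                 DistantProportional
      repeated (h , h′ , h<h′ , eq) = same-ratios (level (h * gap)) (level (h′ * gap))
        (subst (_≤ h′ * gap) (+-comm gap (h * gap)) (*-monoˡ-≤ gap h<h′)) eq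

automatic⇒proportional : {φ : Substitution m} → ProperPrimitive φ → Distinct m →
  (x : Seq (Fin m)) → (∀ n → concatMap φ (prefix x n) ≼ x) →
  ∀ {n} (τ : Fin m → Fin n) → ¬ Periodic (τ ∘ x) → Automatic (τ ∘ x) →
  ∃[ n ] Proportional (Lengths.ℓ φ (suc n)) (Lengths.ℓ φ n)
automatic⇒proportional {zero} pp (() , _)
automatic⇒proportional {suc m} pp distinct x fixed τ nonperiodic
  (k , 2≤k , r , ψ , π , z , uniform , (z-fixed , _) , coded) =
  conclude (distant-proportional 2≤k uniform π z z-fixed coded)
  where
  open AutomaticLengths pp distinct x fixed τ nonperiodic using (distant-proportional)
  open Growth pp
  conclude : ∃[ n ] ∃[ D ] N ≤ D × Proportional (ℓ (n + D)) (ℓ n) → ∃[ n ] Proportional (ℓ (suc n)) (ℓ n)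
  conclude (n , D , N≤D , eq) = n , Perron.consecutive-proportional pp n N≤D eq

-- From an eigenvector to a substitution of constant length

-- Infinite descent: q divides every term f t, and f / q satisfies the same recurrence.
geometric-ratio-integral : ∀ {p q} → Coprime q p → (f : ℕ → ℕ) → 1 ≤ f 0 →
  (∀ t → q * f (suc t) ≡ p * f t) → q ≡ 1
geometric-ratio-integral {p} {q} coprime f 1≤f₀ eq = descent f (<-wellFounded (f 0)) 1≤f₀ eq
  where
  descent : (f : ℕ → ℕ) → Acc _<_ (f 0) → 1 ≤ f 0 → (∀ t → q * f (suc t) ≡ p * f t) → q ≡ 1
  descent f (acc rec) 1≤f₀ eq = by-size q refl
    where
    q∣f : ∀ t → q ∣ f t
    q∣f t = coprime-divisor coprime (divides (f (suc t)) (trans (sym (eq t)) (*-comm q _)))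
    by-size : ∀ r → r ≡ q → q ≡ 1
    by-size zero refl = contradiction (0∣⇒≡0 (q∣f 0)) (m<n⇒n≢0 1≤f₀)
    by-size (suc zero) refl = refl
    by-size (suc (suc r)) refl = descent g (rec g₀<f₀) 1≤g₀ g-eq
      where
      g : ℕ → ℕ
      g t = quotient (q∣f t)
      f≡ : ∀ t → f t ≡ g t * q
      f≡ t = _∣_.equality (q∣f t)
      1≤g₀ : 1 ≤ g 0
      1≤g₀ = n≢0⇒n>0 λ g₀≡0 → m<n⇒n≢0 1≤f₀ (trans (f≡ 0) (cong (_* q) g₀≡0))
      g₀<f₀ : g 0 < f 0
      g₀<f₀ = subst (g 0 <_) (sym (f≡ 0)) (m<m*n (g 0) q {{1≤⇒NonZero 1≤g₀}} (s≤s (s≤s z≤n)))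
      g-eq : ∀ t → q * g (suc t) ≡ p * g t
      g-eq t = *-cancelʳ-≡ _ _ q (begin
        q * g (suc t) * q      ≡⟨ *-assoc q (g (suc t)) q ⟩
        q * (g (suc t) * q)    ≡⟨ cong (q *_) (f≡ (suc t)) ⟨
        q * f (suc t)          ≡⟨ eq t ⟩
        p * f t                ≡⟨ cong (p *_) (f≡ t) ⟩
        p * (g t * q)          ≡⟨ *-assoc p (g t) q ⟨
        p * g t * q            ∎)
        where open ≡-Reasoning

-- After division by the gcd the ratio is in lowest terms, and the descent shows that its
-- denominator is 1.
geometric-ratio-divides : ∀ {α β} → 1 ≤ α → (f : ℕ → ℕ) → 1 ≤ f 0 → (∀ t → α * f (suc t) ≡ β * f t) → α ∣ β
geometric-ratio-divides {α} {β} 1≤α f 1≤f₀ eq = subst (_∣ β) g≡α (gcd[m,n]∣n α β)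
  where
  instance
    α≢0 : NonZero α
    α≢0 = 1≤⇒NonZero 1≤α
    g≢0 : NonZero (gcd α β)
    g≢0 = ≢-nonZero (gcd[m,n]≢0 α β (inj₁ (m<n⇒n≢0 1≤α)))
  g = gcd α β
  α′ = α / g
  β′ = β / g
  α′g≡α : α′ * g ≡ α
  α′g≡α = m/n*n≡m (gcd[m,n]∣m α β)
  β′g≡β : β′ * g ≡ β
  β′g≡β = m/n*n≡m (gcd[m,n]∣n α β)
  swap : ∀ u v → u * v * g ≡ u * g * v
  swap u v = trans (*-assoc u v g) (trans (cong (u *_) (*-comm v g)) (sym (*-assoc u g v)))
  eq′ : ∀ t → α′ * f (suc t) ≡ β′ * f t
  eq′ t = *-cancelʳ-≡ _ _ g (begin
    α′ * f (suc t) * g    ≡⟨ swap α′ _ ⟩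
    α′ * g * f (suc t)    ≡⟨ cong (_* f (suc t)) α′g≡α ⟩
    α * f (suc t)         ≡⟨ eq t ⟩
    β * f t               ≡⟨ cong (_* f t) β′g≡β ⟨
    β′ * g * f t          ≡⟨ swap β′ _ ⟨
    β′ * f t * g          ∎)
    where open ≡-Reasoning
  g≡α : g ≡ α
  g≡α = trans (sym (*-identityˡ g)) (trans (cong (_* g)
    (sym (geometric-ratio-integral (coprime-/gcd α β) f 1≤f₀ eq′))) α′g≡α)

module _ {φ : Substitution m} (pp : ProperPrimitive φ) where
  open Growth pp

  proportional-next : ∀ {n α β} → (∀ c → α * ℓ (suc n) c ≡ β * ℓ n c) → ∀ c → α * ℓ (suc (suc n)) c ≡ β * ℓ (suc n) c
  proportional-next {n} {α} {β} eq c = subst₂ (λ u v → α * u ≡ β * v) (sym (ℓ-suc (suc n) c)) (sym (ℓ-suc n c))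
    (sum-map-scale α β eq (φ c))

  proportional-from : ∀ {n α β} → (∀ c → α * ℓ (suc n) c ≡ β * ℓ n c) → ∀ t c → α * ℓ (suc t + n) c ≡ β * ℓ (t + n) c
  proportional-from eq zero    = eq
  proportional-from {n} {α} {β} eq (suc t) = proportional-next {t + n} {α} {β} (proportional-from {n} {α} {β} eq t)

  -- The lengths of the words φᵗ⁺ˢ(a) form an infinite geometric progression of positive integers,
  -- which forces the ratio β / α to be an integer.
  integral-eigenvalue : ∀ {s} → Proportional (ℓ (suc s)) (ℓ s) → ∃[ k ] ∀ c → ℓ (suc s) c ≡ k * ℓ s c
  integral-eigenvalue {s} (α , β , 1≤α , eq)
    with geometric-ratio-divides {α} {β} 1≤α (λ t → ℓ (t + s) a) (ℓ-positive nonerasing s a)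
           (λ t → proportional-from {s} {α} {β} eq t a)
  ... | divides-refl k = k , λ c → *-cancelˡ-≡ _ _ α {{1≤⇒NonZero 1≤α}} (begin
    α * ℓ (suc s) c      ≡⟨ eq c ⟩
    k * α * ℓ s c        ≡⟨ cong (_* ℓ s c) (*-comm k α) ⟩
    α * k * ℓ s c        ≡⟨ *-assoc α k _ ⟩
    α * (k * ℓ s c)      ∎)
    where open ≡-Reasoning

  -- The factor 0 would give an empty word, and the factor 1 would keep the lengths constant from
  -- level s on, although they are unbounded.
  2≤eigenvalue : Distinct m → ∀ {s k} → (∀ c → ℓ (suc s) c ≡ k * ℓ s c) → 2 ≤ k
  2≤eigenvalue distinct {s} {zero} eq = contradiction (eq a) (m<n⇒n≢0 (ℓ-positive nonerasing (suc s) a))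
  2≤eigenvalue distinct {s} {suc zero} eq = contradiction (bounded (proj₁ large)) (<⇒≱ (proj₂ large a))
    where
    large = growth distinct (suc (ℓ s a))
    constant : ∀ t → ℓ (t + s) a ≡ ℓ s a
    constant zero    = refl
    constant (suc t) = trans (trans (sym (*-identityˡ _)) (trans (proportional-from {s} {1} {1} (λ c → trans (*-identityˡ _) (eq c)) t a)
      (*-identityˡ _))) (constant t)
    bounded : ∀ n → ℓ n a ≤ ℓ s a
    bounded n = ≤-trans (ℓ-mono nonerasing a (m≤m+n n s)) (≤-reflexive (constant n))
  2≤eigenvalue _ {k = suc (suc k)} _ = s≤s (s≤s z≤n)

concat-chunks : ∀ k n (W : List A) → length W ≡ n * k →
  concat (tabulate {n = n} (λ i → take k (drop (toℕ i * k) W))) ≡ W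
concat-chunks k zero    []      _ = refl
concat-chunks k (suc n) W eq = trans (cong (take k W ++_) (trans
    (cong concat (tabulate-cong {n = n} (λ i → cong (take k) (sym (drop-drop k (toℕ i * k) W)))))
    (concat-chunks k n (drop k W) (trans (length-drop k W) (trans (cong (_∸ k) eq) (m+n∸m≡n k (n * k)))))))
  (take++drop≡id k W)

length-chunk : ∀ k n (W : List A) → length W ≡ n * k → ∀ {i} → i < n → length (take k (drop (i * k) W)) ≡ k
length-chunk k n W eq {i} i<n = trans (length-take k (drop (i * k) W)) (m≤n⇒m⊓n≡m (begin
  k                         ≡⟨ m+n∸n≡m k (i * k) ⟨
  k + i * k ∸ i * k         ≤⟨ ∸-monoˡ-≤ (i * k) (*-monoˡ-≤ k i<n) ⟩
  n * k ∸ i * k             ≡⟨ cong (_∸ i * k) eq ⟨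
  length W ∸ i * k          ≡⟨ length-drop (i * k) W ⟨
  length (drop (i * k) W)   ∎))
  where open ≤-Reasoning

-- A substitution of constant length must have images of length k also at the letters of the
-- encoding that stand for no position; these receive a constant word.
orReplicate : ℕ → A → List A → List A
orReplicate k e w with length w ≟ k
... | yes _ = w
... | no  _ = replicate k e

length-orReplicate : ∀ k (e : A) w → length (orReplicate k e w) ≡ k
length-orReplicate k e w with length w ≟ k
... | yes eq = eq
... | no  _  = length-replicate k

orReplicate-≡ : ∀ k (e : A) w → length w ≡ k → orReplicate k e w ≡ w
orReplicate-≡ k e w eq with length w ≟ k
... | yes _  = refl
... | no ¬eq = contradiction eq ¬eq

nth : A → List A → ℕ → A
nth d []      _       = d
nth d (c ∷ w) zero    = c
nth d (c ∷ w) (suc i) = nth d w i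

nth-lookup : (d : A) (w : List A) (i : Fin (length w)) → nth d w (toℕ i) ≡ lookup w i
nth-lookup d (c ∷ w) zero    = refl
nth-lookup d (c ∷ w) (suc i) = nth-lookup d w i

concatMap-concatMap : {C : Set} (f : B → List C) (g : A → List B) (w : List A) →
  concatMap f (concatMap g w) ≡ concatMap (concatMap f ∘ g) w
concatMap-concatMap f g []      = refl
concatMap-concatMap f g (c ∷ w) = trans (concatMap-++ f (g c) (concatMap g w)) (cong (concatMap f (g c) ++_) (concatMap-concatMap f g w))

-- The letter (b , i) stands for the i-th letter of φˢ(b); it is encoded as combine b i, so that
-- there are additional unused letters (b , i) with i ≥ |φˢ(b)|.
module UniformModel (φ : Substitution m) (τ : Fin m → Fin n) (s k : ℕ)
                    (eigen : ∀ b → Lengths.ℓ φ (suc s) b ≡ k * Lengths.ℓ φ s b) where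
  open Lengths φ

  private
    S = proj₁ (Fin-bounded (ℓ s))
    ℓ≤S = proj₂ (Fin-bounded (ℓ s))

  Letter : Set
  Letter = Fin (m * S)

  expand : Fin m → List Letter
  expand b = tabulate {n = ℓ s b} (λ i → combine b (inject≤ i (ℓ≤S b)))

  -- By the eigenvector equation the expansion of φ(b) has length k ℓₛ(b). It is therefore cut into
  -- ℓₛ(b) pieces of length k, one for each letter of `expand b`.
  chunk : Fin m → ℕ → List Letter
  chunk b i = take k (drop (i * k) (concatMap expand (φ b)))

  letterOf : Letter → Fin m
  letterOf e = proj₁ (remQuot S e)

  indexOf : Letter → ℕ
  indexOf e = toℕ (proj₂ (remQuot {m} S e))

  ψ : Substitution (m * S)
  ψ e = orReplicate k e (chunk (letterOf e) (indexOf e))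

  ψ-uniform : HasConstantLength k ψ
  ψ-uniform e = length-orReplicate k e (chunk (letterOf e) (indexOf e))

  -- The default value of `nth` is reached only at letters (b , i) with i ≥ |φˢ(b)|.
  π : Letter → Fin n
  π e = τ (nth (letterOf e) (iterateSubst φ s [ letterOf e ]) (indexOf e))

  module _ (b : Fin m) (i : Fin (ℓ s b)) where
    private e = combine b (inject≤ i (ℓ≤S b))

    letterOf-combine : letterOf e ≡ b
    letterOf-combine = cong proj₁ (Fin.remQuot-combine {k = S} b (inject≤ i (ℓ≤S b)))

    indexOf-combine : indexOf e ≡ toℕ i
    indexOf-combine = trans (cong (toℕ ∘ proj₂) (Fin.remQuot-combine {k = S} b (inject≤ i (ℓ≤S b))))
      (Fin.toℕ-inject≤ i (ℓ≤S b))

  length-expand : ∀ w → length (concatMap expand w) ≡ sum (map (ℓ s) w)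
  length-expand []      = refl
  length-expand (b ∷ w) = trans (length-++ (expand b)) (cong₂ _+_ (length-tabulate {n = ℓ s b} _) (length-expand w))

  length-expand-φ : ∀ b → length (concatMap expand (φ b)) ≡ ℓ s b * k
  length-expand-φ b = begin
    length (concatMap expand (φ b))               ≡⟨ length-expand (φ b) ⟩
    sum (map (ℓ s) (φ b))                         ≡⟨ ℓ-suc s b ⟨
    ℓ (suc s) b                                   ≡⟨ eigen b ⟩
    k * ℓ s b                                     ≡⟨ *-comm k _ ⟩
    ℓ s b * k                                     ∎
    where open ≡-Reasoning

  ψ-letter : ∀ b (i : Fin (ℓ s b)) → ψ (combine b (inject≤ i (ℓ≤S b))) ≡ chunk b (toℕ i)
  ψ-letter b i = trans
    (cong₂ (λ c j → orReplicate k e (chunk c j)) (letterOf-combine b i) (indexOf-combine b i))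
    (orReplicate-≡ k e _ (length-chunk k (ℓ s b) _ (length-expand-φ b) (Fin.toℕ<n i)))
    where e = combine b (inject≤ i (ℓ≤S b))

  ψ∘expand : ∀ b → concatMap ψ (expand b) ≡ concatMap expand (φ b)
  ψ∘expand b = begin
    concat (map ψ (expand b))                             ≡⟨ cong concat (map-tabulate {n = ℓ s b} _ ψ) ⟩
    concat (tabulate {n = ℓ s b} (λ i → ψ (combine b (inject≤ i (ℓ≤S b)))))  ≡⟨ cong concat (tabulate-cong {n = ℓ s b} (ψ-letter b)) ⟩
    concat (tabulate {n = ℓ s b} (λ i → chunk b (toℕ i)))  ≡⟨ concat-chunks k (ℓ s b) _ (length-expand-φ b) ⟩
    concatMap expand (φ b)                                ∎
    where open ≡-Reasoning

  π-letter : ∀ b (i : Fin (ℓ s b)) → π (combine b (inject≤ i (ℓ≤S b))) ≡ τ (lookup (iterateSubst φ s [ b ]) i)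
  π-letter b i = cong τ (trans
    (cong₂ (λ c j → nth c (iterateSubst φ s [ c ]) j) (letterOf-combine b i) (indexOf-combine b i))
    (nth-lookup b (iterateSubst φ s [ b ]) i))

  π∘expand : ∀ b → map π (expand b) ≡ map τ (iterateSubst φ s [ b ])
  π∘expand b = begin
    map π (expand b)                                                  ≡⟨ map-tabulate {n = ℓ s b} _ π ⟩
    tabulate {n = ℓ s b} (λ i → π (combine b (inject≤ i (ℓ≤S b))))    ≡⟨ tabulate-cong {n = ℓ s b} (π-letter b) ⟩
    tabulate (τ ∘ lookup (iterateSubst φ s [ b ]))                    ≡⟨ map-tabulate (lookup (iterateSubst φ s [ b ])) τ ⟨
    map τ (tabulate (lookup (iterateSubst φ s [ b ])))                ≡⟨ cong (map τ) (tabulate-lookup (iterateSubst φ s [ b ])) ⟩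
    map τ (iterateSubst φ s [ b ])                                    ∎
    where open ≡-Reasoning

-- Transport of fixed points along a commuting morphism

image : (σ : A → List B) → (∀ b → 1 ≤ length (σ b)) → (x : Seq A) →
        Σ[ z ∈ Seq B ] ∀ n → concatMap σ (prefix x n) ≼ z
image {A} {B} σ nonerasing x = flat [] x , spec [] x
  where
  uncons : (w : List B) → 1 ≤ length w → ∃[ c ] ∃[ u ] w ≡ c ∷ u
  uncons (c ∷ u) _ = c , u , refl
  hd : A → B
  hd b = proj₁ (uncons (σ b) (nonerasing b))
  tl : A → List B
  tl b = proj₁ (proj₂ (uncons (σ b) (nonerasing b)))
  hd∷tl : ∀ b → hd b ∷ tl b ≡ σ b
  hd∷tl b = sym (proj₂ (proj₂ (uncons (σ b) (nonerasing b))))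
  -- The list holds the part of the current image that is still to be emitted: `flat u x` is `u`
  -- followed by σ(x).
  flat : List B → Seq A → Seq B
  flat []      x zero    = hd (x 0)
  flat []      x (suc i) = flat (tl (x 0)) (x ∘ suc) i
  flat (c ∷ u) x zero    = c
  flat (c ∷ u) x (suc i) = flat u x i
  spec : ∀ u x n → (u ++ concatMap σ (prefix x n)) ≼ flat u x
  spec (c ∷ u) x n       = cong (c ∷_) (spec u x n)
  spec []      x zero    = refl
  spec []      x (suc n) = subst (λ v → (v ++ concatMap σ (prefix (x ∘ suc) n)) ≼ flat [] x) (hd∷tl (x 0))
    (cong (hd (x 0) ∷_) (spec (tl (x 0)) (x ∘ suc) n))

++-≼⁻ˡ : (u : List A) {v : List A} {z : Seq A} → (u ++ v) ≼ z → u ≼ z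
++-≼⁻ˡ []      p = refl
++-≼⁻ˡ (c ∷ u) p = cong₂ _∷_ (∷-injectiveˡ p) (++-≼⁻ˡ u (∷-injectiveʳ p))

map-≼ : (f : A → B) {w : List A} {z : Seq A} → w ≼ z → map f w ≼ (f ∘ z)
map-≼ f {[]}    p = refl
map-≼ f {c ∷ w} p = cong₂ _∷_ (cong f (∷-injectiveˡ p)) (map-≼ f {w} (∷-injectiveʳ p))

∃-prefix-++ : (w : List A) {z : Seq A} → w ≼ z → ∀ {i} → i ≤ length w → ∃[ v ] w ≡ prefix z i ++ v
∃-prefix-++ w {z} p {i} i≤ = prefix (λ e → z (i + e)) (length w ∸ i) , (begin
  w                                                        ≡⟨ p ⟨
  prefix z (length w)                                      ≡⟨ cong (prefix z) (m+[n∸m]≡n i≤) ⟨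
  prefix z (i + (length w ∸ i))                            ≡⟨ prefix-+ z i _ ⟩
  prefix z i ++ prefix (λ e → z (i + e)) (length w ∸ i)    ∎)
  where open ≡-Reasoning

-- The sequence z = σ(x) is fixed because ψ(σ(x)) = σ(φ(x)) = σ(x), and it codes correctly because
-- π(σ(x)) = τ(φˢ(x)) = τ(x).
transport : ∀ {r} {φ : Substitution m} {ψ : Substitution r} (σ : Fin m → Word r) → (∀ b → 1 ≤ length (σ b)) →
  (∀ b → concatMap ψ (σ b) ≡ concatMap σ (φ b)) →
  ∀ {s} {τ : Fin m → Fin n} {π : Fin r → Fin n} → (∀ b → map π (σ b) ≡ map τ (iterateSubst φ s [ b ])) →
  (x : Seq (Fin m)) → (∀ i → concatMap φ (prefix x i) ≼ x) →
  Σ[ z ∈ Seq (Fin r) ] (∀ i → concatMap ψ (prefix z i) ≼ z) × (∀ i → τ (x i) ≡ π (z i))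
transport {φ = φ} {ψ} σ nonerasing commutes {s} {τ} {π} coded x fixed = z , z-fixed , coding
  where
  z = proj₁ (image σ nonerasing x)
  σx≼z = proj₂ (image σ nonerasing x)
  open FixedPoint φ x fixed using (iterate-≼; iterate-++; iterate-[])

  length-σ : ∀ i → i ≤ length (concatMap σ (prefix x i))
  length-σ i = subst (_≤ length (concatMap σ (prefix x i))) (length-applyUpTo x i)
    (length-concatMap-≥ nonerasing (prefix x i))

  ψσx≼z : ∀ i → concatMap ψ (concatMap σ (prefix x i)) ≼ z
  ψσx≼z i = subst (_≼ z) (begin
    concatMap σ (prefix x (length (concatMap φ (prefix x i))))   ≡⟨ cong (concatMap σ) (fixed i) ⟩
    concatMap σ (concatMap φ (prefix x i))                       ≡⟨ concatMap-concatMap σ φ (prefix x i) ⟩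
    concatMap (concatMap σ ∘ φ) (prefix x i)                     ≡⟨ concatMap-cong commutes (prefix x i) ⟨
    concatMap (concatMap ψ ∘ σ) (prefix x i)                     ≡⟨ concatMap-concatMap ψ σ (prefix x i) ⟨
    concatMap ψ (concatMap σ (prefix x i))                       ∎) (σx≼z (length (concatMap φ (prefix x i))))
    where open ≡-Reasoning

  -- No image under σ is empty, so the first i letters of z already lie in the image of the first i
  -- letters of x.
  z-fixed : ∀ i → concatMap ψ (prefix z i) ≼ z
  z-fixed i with ∃-prefix-++ (concatMap σ (prefix x i)) (σx≼z i) (length-σ i)
  ... | v , eq = ++-≼⁻ˡ (concatMap ψ (prefix z i))
    (subst (_≼ z) (trans (cong (concatMap ψ) eq) (concatMap-++ ψ (prefix z i) v)) (ψσx≼z i))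

  map-π-σ : ∀ w → map π (concatMap σ w) ≡ map τ (iterateSubst φ s w)
  map-π-σ []      = cong (map τ) (sym (iterate-[] s))
  map-π-σ (b ∷ w) = begin
    map π (σ b ++ concatMap σ w)                                     ≡⟨ map-++ π (σ b) _ ⟩
    map π (σ b) ++ map π (concatMap σ w)                             ≡⟨ cong₂ _++_ (coded b) (map-π-σ w) ⟩
    map τ (iterateSubst φ s [ b ]) ++ map τ (iterateSubst φ s w)     ≡⟨ map-++ τ (iterateSubst φ s [ b ]) _ ⟨
    map τ (iterateSubst φ s [ b ] ++ iterateSubst φ s w)             ≡⟨ cong (map τ) (iterate-++ s [ b ] w) ⟨
    map τ (iterateSubst φ s (b ∷ w))                                 ∎
    where open ≡-Reasoning

  coding : ∀ i → τ (x i) ≡ π (z i)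
  coding i = ≼-agree {u = map π (concatMap σ (prefix x (suc i)))}
    (subst (_≼ (τ ∘ x)) (sym (map-π-σ (prefix x (suc i)))) (map-≼ τ {iterateSubst φ s (prefix x (suc i))} (iterate-≼ s (suc i))))
    (map-≼ π {concatMap σ (prefix x (suc i))} (σx≼z (suc i)))
    (subst (i <_) (sym (length-map π (concatMap σ (prefix x (suc i))))) (length-σ (suc i)))

-- Two-sided sequences

open import Data.Integer as ℤ using (+_; -[1+_]; _⊖_)
import Data.Integer.Properties as ℤ

right-half left-half : TwoSided.Seq A → Seq A
right-half x i = x (+ i)
left-half x i = x -[1+ i ]

join-halves : Seq A → Seq A → TwoSided.Seq A
join-halves l r (+ i)    = r i
join-halves l r -[1+ i ] = l i

left-⊖ : (x : TwoSided.Seq A) (n : ℕ) → left x n ≡ prefix (λ k → x (k ⊖ n)) n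
left-⊖ x n = prefix-cong (λ k → cong x (ℤ.-m+n≡n⊖m n k)) n

left-reverse : (x : TwoSided.Seq A) (n : ℕ) → left x n ≡ reverse (prefix (left-half x) n)
left-reverse x n = trans (left-⊖ x n) (trans (downFrom n) (sym (reverse-applyUpTo (left-half x) n)))
  where
  downFrom : ∀ n → prefix (λ k → x (k ⊖ n)) n ≡ applyDownFrom (left-half x) n
  downFrom zero    = refl
  downFrom (suc n) = cong (x -[1+ n ] ∷_)
    (trans (prefix-cong (λ k → cong x (ℤ.[1+m]⊖[1+n]≡m⊖n k n)) n) (downFrom n))

reverse-left : (x : TwoSided.Seq A) (n : ℕ) → reverse (left x n) ≡ prefix (left-half x) n
reverse-left x n = trans (cong reverse (left-reverse x n)) (reverse-involutive _)

mirror : (A → List B) → A → List B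
mirror f b = reverse (f b)

concatMap-mirror : (f : A → List B) (w : List A) → concatMap (mirror f) (reverse w) ≡ reverse (concatMap f w)
concatMap-mirror f []      = refl
concatMap-mirror f (c ∷ w) = begin
  concatMap (mirror f) (reverse (c ∷ w))                   ≡⟨ cong (concatMap (mirror f)) (unfold-reverse c w) ⟩
  concatMap (mirror f) (reverse w ++ [ c ])                ≡⟨ concatMap-++ (mirror f) (reverse w) [ c ] ⟩
  concatMap (mirror f) (reverse w) ++ (mirror f c ++ [])   ≡⟨ cong₂ _++_ (concatMap-mirror f w) (++-identityʳ _) ⟩
  reverse (concatMap f w) ++ reverse (f c)                 ≡⟨ reverse-++ (f c) (concatMap f w) ⟨
  reverse (f c ++ concatMap f w)                           ∎
  where open ≡-Reasoning

iterate-mirror : (φ : Substitution m) (s : ℕ) (b : Fin m) →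
  iterateSubst (mirror φ) s [ b ] ≡ reverse (iterateSubst φ s [ b ])
iterate-mirror φ zero    b = refl
iterate-mirror φ (suc s) b = trans (cong (concatMap (mirror φ)) (iterate-mirror φ s b))
  (concatMap-mirror φ (iterateSubst φ s [ b ]))

module _ (φ : Substitution m) (x : TwoSided.Seq (Fin m)) where

  concatMap-mirror-prefix : ∀ n → concatMap (mirror φ) (prefix (left-half x) n) ≡ reverse (concatMap φ (left x n))
  concatMap-mirror-prefix n = trans (cong (concatMap (mirror φ)) (sym (reverse-left x n))) (concatMap-mirror φ (left x n))

  -- Reversal exchanges words ending at the origin with prefixes of the left half read outwards.
  left-fixed⇒mirror-fixed : (∀ n → let w = concatMap φ (left x n) in left x (length w) ≡ w) →
    ∀ n → concatMap (mirror φ) (prefix (left-half x) n) ≼ left-half x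
  left-fixed⇒mirror-fixed fixed n = subst (_≼ left-half x) (sym (concatMap-mirror-prefix n)) (begin
    prefix (left-half x) (length (reverse w))    ≡⟨ cong (prefix (left-half x)) (length-reverse w) ⟩
    prefix (left-half x) (length w)              ≡⟨ reverse-left x (length w) ⟨
    reverse (left x (length w))                  ≡⟨ cong reverse (fixed n) ⟩
    reverse w                                    ∎)
    where
    open ≡-Reasoning
    w = concatMap φ (left x n)

  mirror-fixed⇒left-fixed : (∀ n → concatMap (mirror φ) (prefix (left-half x) n) ≼ left-half x) →
    ∀ n → let w = concatMap φ (left x n) in left x (length w) ≡ w
  mirror-fixed⇒left-fixed fixed n = begin
    left x (length w)                                        ≡⟨ left-reverse x (length w) ⟩
    reverse (prefix (left-half x) (length w))                ≡⟨ cong (λ k → reverse (prefix (left-half x) k)) (length-reverse w) ⟨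
    reverse (prefix (left-half x) (length (reverse w)))      ≡⟨ cong reverse (subst (_≼ left-half x) (concatMap-mirror-prefix n) (fixed n)) ⟩
    reverse (reverse w)                                      ≡⟨ reverse-involutive w ⟩
    w                                                        ∎
    where
    open ≡-Reasoning
    w = concatMap φ (left x n)

uniform-unbounded : ∀ {k} {ψ : Substitution m} → HasConstantLength k ψ → 1 ≤ k →
  (u : ℕ → Word m) → (∀ n → length (u n) ≡ n) → ∀ N → ∃[ n ] N ≤ length (concatMap ψ (u n))
uniform-unbounded {k = k} uniform 1≤k u length-u N = N ,
  subst (N ≤_) (sym (trans (length-concatMap-uniform uniform (u N)) (cong (k *_) (length-u N)))) (m≤k*m N 1≤k)

-- Collects what transport requires. The identities survive the reversal of σ, ψ and φ, so the same
-- data serve both halves of a two-sided sequence.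
record UniformExpansion (φ : Substitution m) (τ : Fin m → Fin n) (s k : ℕ) : Set where
  field
    {size}     : ℕ
    σ          : Fin m → Word size
    1≤length-σ : ∀ b → 1 ≤ length (σ b)
    ψ          : Substitution size
    ψ-uniform  : HasConstantLength k ψ
    ψ∘σ        : ∀ b → concatMap ψ (σ b) ≡ concatMap σ (φ b)
    π          : Fin size → Fin n
    π∘σ        : ∀ b → map π (σ b) ≡ map τ (iterateSubst φ s [ b ])

uniformExpansion : {φ : Substitution m} → ProperPrimitive φ → (τ : Fin m → Fin n) → ∀ {s k} →
  (∀ b → Lengths.ℓ φ (suc s) b ≡ k * Lengths.ℓ φ s b) → UniformExpansion φ τ s k
uniformExpansion {φ = φ} pp τ {s} {k} eigen = record
  { σ = expand
  ; 1≤length-σ = λ b → subst (1 ≤_) (sym (length-tabulate {n = ℓ s b} _)) (ℓ-positive nonerasing s b)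
  ; ψ = ψ ; ψ-uniform = ψ-uniform ; ψ∘σ = ψ∘expand ; π = π ; π∘σ = π∘expand }
  where
  open Growth pp
  open UniformModel φ τ s k eigen

module _ {φ : Substitution m} {τ : Fin m → Fin n} {s k : ℕ} (2≤k : 2 ≤ k) (E : UniformExpansion φ τ s k) where
  open UniformExpansion E

  expansion⇒automatic : (x : Seq (Fin m)) → (∀ n → concatMap φ (prefix x n) ≼ x) → OneSided.Automatic (τ ∘ x)
  expansion⇒automatic x fixed with transport σ 1≤length-σ ψ∘σ {s} {τ} {π} π∘σ x fixed
  ... | z , z-fixed , coded = k , 2≤k , size , ψ , π , z , ψ-uniform ,
        (z-fixed , uniform-unbounded ψ-uniform (<⇒≤ 2≤k) (prefix z) (length-applyUpTo z)) , coded

  -- The left half is transported with the mirrored σ and ψ but with the same alphabet and coding,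
  -- so both halves can be glued at the origin to a fixed point of `ψ` itself.
  expansion⇒automatic₂ : (x : TwoSided.Seq (Fin m)) → TwoSided.IsFixedPoint φ x → TwoSided.Automatic (τ ∘ x)
  expansion⇒automatic₂ x (right-fixed , left-fixed , _)
    with transport σ 1≤length-σ ψ∘σ {s} {τ} {π} π∘σ (right-half x) right-fixed
       | transport {φ = mirror φ} {mirror ψ} (mirror σ)
           (λ b → subst (1 ≤_) (sym (length-reverse (σ b))) (1≤length-σ b))
           (λ b → trans (concatMap-mirror ψ (σ b)) (trans (cong reverse (ψ∘σ b)) (sym (concatMap-mirror σ (φ b)))))
           {s} {τ} {π}
           (λ b → trans (reverse-map π (σ b)) (trans (cong reverse (π∘σ b))
             (trans (sym (reverse-map τ (iterateSubst φ s [ b ]))) (cong (map τ) (sym (iterate-mirror φ s b))))))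
           (left-half x) (left-fixed⇒mirror-fixed φ x left-fixed)
  ... | zʳ , zʳ-fixed , codedʳ | zˡ , zˡ-fixed , codedˡ = k , 2≤k , size , ψ , π , z , ψ-uniform ,
      (zʳ-fixed , mirror-fixed⇒left-fixed ψ z zˡ-fixed ,
        unbounded (right z) (λ i → length-applyUpTo _ i) , unbounded (left z) (λ i → length-applyUpTo _ i)) , coded
    where
    z = join-halves zˡ zʳ
    unbounded = uniform-unbounded ψ-uniform (<⇒≤ 2≤k)
    coded : ∀ i → τ (x i) ≡ π (z i)
    coded (+ i)    = codedʳ i
    coded -[1+ i ] = codedˡ i

automatic₂⇒right-automatic : (y : TwoSided.Seq (Fin n)) → TwoSided.Automatic y → OneSided.Automatic (right-half y)
automatic₂⇒right-automatic y (k , 2≤k , r , ψ , π , z , uniform , (right-fixed , _ , unbounded , _) , coded) =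
  k , 2≤k , r , ψ , π , right-half z , uniform , (right-fixed , unbounded) , coded ∘ +_

-- Every factor of x around the origin lies in φⁿ⁺¹(x₋₁)φⁿ(a) for some n, which also occurs in the right half.
right-periodic⇒periodic : {φ : Substitution m} → ProperPrimitive φ → Distinct m →
  (x : TwoSided.Seq (Fin m)) → TwoSided.IsFixedPoint φ x → (τ : Fin m → B) →
  OneSided.Periodic (right-half (τ ∘ x)) → TwoSided.Periodic (τ ∘ x)
right-periodic⇒periodic {φ = φ} pp distinct x (right-fixed , left-fixed , _) τ (p , 1≤p , periodic) =
  p , 1≤p , periodic₂
  where
  open Recurrence pp (right-half x) right-fixed
  open FixedPoint φ (right-half x) right-fixed using (block-≼)

  iterate-left : ∀ n i → let w = iterateSubst φ n (left x i) in left x (length w) ≡ w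
  iterate-left zero    i = cong (left x) (length-applyUpTo _ i)
  iterate-left (suc n) i = subst (λ w → left x (length (concatMap φ w)) ≡ concatMap φ w)
    (iterate-left n i) (left-fixed (length (iterateSubst φ n (left x i))))

  b = x -[1+ 0 ]

  periodic₂ : ∀ i → τ (x (i ℤ.+ + p)) ≡ τ (x i)
  periodic₂ (+ i)    = periodic i
  -- The level n is so large that φⁿ⁺¹(b)φⁿ(a), placed with its first part ending at the origin,
  -- covers both positions -1-i and -1-i+p. The index j is an occurrence of b in the right half.
  periodic₂ -[1+ i ] with growth distinct (suc i + p) | find-letter b
  ... | n , large | j , _ , xj≡b = begin
      τ (x (-[1+ i ] ℤ.+ + p))        ≡⟨ cong (λ t → τ (x (t ℤ.+ + p))) k⊖ℓ ⟨
      τ (x ((k ⊖ ℓₙ) ℤ.+ + p))        ≡⟨ cong (τ ∘ x) (ℤ.distribˡ-⊖-+-pos p k ℓₙ) ⟩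
      τ (x ((k + p) ⊖ ℓₙ))            ≡⟨ cong τ (around (k + p) k+p<) ⟩
      τ (x (+ (Q + (k + p))))         ≡⟨ cong (λ t → τ (x (+ t))) (+-assoc Q k p) ⟨
      τ (x (+ (Q + k + p)))           ≡⟨ periodic (Q + k) ⟩
      τ (x (+ (Q + k)))               ≡⟨ cong τ (around k (≤-<-trans (m≤m+n k p) k+p<)) ⟨
      τ (x (k ⊖ ℓₙ))                  ≡⟨ cong (τ ∘ x) k⊖ℓ ⟩
      τ (x -[1+ i ])                  ∎
    where
    open ≡-Reasoning
    ℓₙ = ℓ (suc n) b
    Q = P (suc n) j
    i+p<ℓ : ∀ c → suc i + p ≤ ℓ (suc n) c
    i+p<ℓ c = ≤-trans (large c) (ℓ-mono nonerasing c (n≤1+n n))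
    i<ℓ : suc i ≤ ℓₙ
    i<ℓ = m+n≤o⇒m≤o (suc i) (i+p<ℓ b)
    -- The offset of position -1-i within the copy of φⁿ⁺¹(b) that ends at the origin.
    k = ℓₙ ∸ suc i
    k+1+i≡ℓ : k + suc i ≡ ℓₙ
    k+1+i≡ℓ = m∸n+n≡m i<ℓ
    k⊖ℓ : k ⊖ ℓₙ ≡ -[1+ i ]
    k⊖ℓ = trans (cong₂ _⊖_ (sym (+-identityʳ k)) (sym k+1+i≡ℓ)) (ℤ.+-cancelˡ-⊖ k 0 (suc i))
    k+p< : k + p < ℓₙ + ℓ n a
    k+p< = +-mono-≤ (subst (suc k ≤_) k+1+i≡ℓ (subst (suc k ≤_) (sym (+-suc k i)) (s≤s (m≤m+n k i))))
      (≤-trans (m≤n+m p (suc i)) (large a))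
    -- Both sides read φⁿ⁺¹(b)φⁿ(a). On the left the second part begins at the origin, on the right
    -- it begins the block following that of x_j.
    around : ∀ t → t < ℓₙ + ℓ n a → x (t ⊖ ℓₙ) ≡ x (+ (Q + t))
    around t t< with t <? ℓₙ
    ... | yes t<ℓ = ≼-agree {u = iterateSubst φ (suc n) [ b ]} {λ k → x (k ⊖ ℓₙ)}
            (trans (sym (left-⊖ x ℓₙ)) (iterate-left (suc n) 1))
            (subst (λ c → iterateSubst φ (suc n) [ c ] ≼ (λ e → x (+ (Q + e)))) xj≡b (block-≼ (suc n) j)) t<ℓ
    ... | no  t≮ℓ = subst (λ t → x (t ⊖ ℓₙ) ≡ x (+ (Q + t))) (m+[n∸m]≡n (≮⇒≥ t≮ℓ)) (begin
        x ((ℓₙ + d) ⊖ ℓₙ)             ≡⟨ cong (λ r → x ((ℓₙ + d) ⊖ r)) (+-identityʳ ℓₙ) ⟨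
        x ((ℓₙ + d) ⊖ (ℓₙ + 0))       ≡⟨ cong x (ℤ.+-cancelˡ-⊖ ℓₙ d 0) ⟩
        x (+ d)                       ≡⟨ block-start proper n (suc j) d<ℓ ⟨
        x (+ (P (suc n) (suc j) + d)) ≡⟨ cong (λ r → x (+ (r + d))) (trans (P-suc (suc n) j) (cong (λ c → Q + ℓ (suc n) c) xj≡b)) ⟩
        x (+ (Q + ℓₙ + d))            ≡⟨ cong (λ r → x (+ r)) (+-assoc Q ℓₙ d) ⟩
        x (+ (Q + (ℓₙ + d)))          ∎)
      where
      d = t ∸ ℓₙ
      d<ℓ : d < ℓ n a
      d<ℓ = +-cancelˡ-< ℓₙ d (ℓ n a) (subst (_< ℓₙ + ℓ n a) (sym (m+[n∸m]≡n (≮⇒≥ t≮ℓ))) t<)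

-- The equivalence for one-sided and for two-sided fixed points

corollary1p1 :
    ∀ {c ℓ₁ ℓ₂} (K : CharZeroField c ℓ₁ ℓ₂) →
    let open CharZeroField K
        open Spectral K
    in
    (m n : ℕ) (φ : Substitution m) → Primitive φ → LeftProper φ →
    let M = fromℕᴹ (incidenceMatrix φ) in
    (J : JordanForm M) →
    let s = largestBlockSize J 0#
        lengths = λ a → fromℕ (length (iterateSubst φ s [ a ]))
    in
    (τ : Fin m → Fin n) →
      ((x : OneSided.Seq (Fin m)) → OneSided.IsFixedPoint φ x →
        ¬ OneSided.Periodic (τ ∘ x) →
        OneSided.Automatic (τ ∘ x) ⇔ IsLeftEigenvector lengths M)
    × ((x : TwoSided.Seq (Fin m)) → TwoSided.IsFixedPoint φ x → TwoSided.Admissible φ x →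
        ¬ TwoSided.Periodic (τ ∘ x) →
        TwoSided.Automatic (τ ∘ x) ⇔ IsLeftEigenvector lengths M)
corollary1p1 K m n φ φ-primitive φ-proper J τ =
  (λ x fixed nonperiodic →
    -- A constant x would have period 1, so nonperiodicity yields two letters; growth of the lengths
    -- rests on this.
    let distinct = distinct-letters x 0 λ constant → nonperiodic (1 , ≤-refl , λ i → cong τ (constant (i + 1) i)) in
    mk⇔ (proportional⇒eigenvector J ∘ automatic⇒proportional pp distinct x (proj₁ fixed) τ nonperiodic)
        (λ eigen → expansion⇒automatic (2≤k distinct eigen) (expansion eigen) x (proj₁ fixed))) ,
  (λ x fixed _ nonperiodic →
    let distinct = distinct-letters x (+ 0) λ constant → nonperiodic (1 , ≤-refl , λ i → cong τ (constant (i ℤ.+ + 1) i)) in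
    mk⇔ (proportional⇒eigenvector J
          ∘ automatic⇒proportional pp distinct (right-half x) (proj₁ fixed) τ
              (nonperiodic ∘ right-periodic⇒periodic pp distinct x fixed τ)
          ∘ automatic₂⇒right-automatic (τ ∘ x))
        (λ eigen → expansion⇒automatic₂ (2≤k distinct eigen) (expansion eigen) x fixed))
  where
  open Spectral K
  pp = properPrimitive φ φ-primitive φ-proper
  open Growth pp
  open Eigenvector K φ a ℓ ℓ-suc (ℓ-positive nonerasing)
  s = largestBlockSize J (CharZeroField.0# K)
  eigenvalue-of : IsLeftEigenvector (L s) (fromℕᴹ (incidenceMatrix φ)) → ∃[ k ] ∀ b → ℓ (suc s) b ≡ k * ℓ s b
  eigenvalue-of eigen = integral-eigenvalue pp {s} (eigenvector⇒proportional {s} eigen)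
  2≤k : Distinct m → ∀ eigen → 2 ≤ proj₁ (eigenvalue-of eigen)
  2≤k distinct eigen = 2≤eigenvalue pp distinct {s} (proj₂ (eigenvalue-of eigen))
  expansion : ∀ eigen → UniformExpansion φ τ s (proj₁ (eigenvalue-of eigen))
  expansion eigen = uniformExpansion pp τ {s} (proj₂ (eigenvalue-of eigen))
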